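{- Let $n,s,k,r$ be integers with $s\ge 1$, $n\ge 2s+1$ and $k\ge r\ge 3$. Then $$\mathrm{ex}(n,K_r,\{K_{k+1},M_{s+1}\})=\max\{N(T_k(2s+1),K_r),\,N(G_k(n,s),K_r)\}.$$
   Context: For graphs $T$, $G$, $N(G,T)$ denotes the number of (not necessarily induced) copies of $T$ in $G$. For a graph $T$ and a family of graphs $\mathcal{H}$, $\mathrm{ex}(n,T,\mathcal{H})$ is the maximum of $N(G,T)$ over all $n$-vertex graphs $G$ containing no member of $\mathcal{H}$ as a subgraph. $K_{m}$ is the complete graph on $m$ vertices and $M_{m}$ is a matching consisting of $m$ edges. The Turán graph $T_k(m)$ is the complete $k$-partite graph on $m$ vertices whose part sizes are as equal as possible. $G_k(n,s)$ is the join of an empty graph on $n-s$ vertices with $T_{k-1}(s)$, i.e. the complete $k$-partite graph on $n$ vertices with one part of size $n-s$ and the other $k-1$ parts of sizes as equal as possible (summing to $s$). -}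

module Defs where

open import Data.Bool using (Bool; true; false; not; _∧_; if_then_else_)
open import Data.Nat using (ℕ; zero; suc; _+_; _*_; _∸_; _<ᵇ_; _≡ᵇ_; _%_; _/_)
open import Data.Fin using (Fin; toℕ)
open import Data.Fin.Subset using (Subset; ∣_∣)
open import Data.Vec using (Vec; []; _∷_; lookup)
open import Data.List using (List; []; _∷_; _++_; map; concatMap; length; filterᵇ; allFin)
open import Data.Bool.ListAction using (and)
open import Data.Product using (Σ; _×_; _,_)
open import Relation.Binary.PropositionalEquality using (_≡_)
open import Function.Definitions using (Injective)

record Graph (n : ℕ) : Set where
  field
    adj   : Fin n → Fin n → Bool
    sym   : ∀ i j → adj i j ≡ adj j i
    irrefl : ∀ i → adj i i ≡ false
open Graph public

_=ᶠ_ : ∀ {n} → Fin n → Fin n → Bool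
i =ᶠ j = toℕ i ≡ᵇ toℕ j

_⊆ᴳ_ : ∀ {m n} → Graph m → Graph n → Set
_⊆ᴳ_ {m} {n} H G =
  Σ (Fin m → Fin n) λ f →
    Injective _≡_ _≡_ f × (∀ i j → adj H i j ≡ true → adj G (f i) (f j) ≡ true)

allSubsets : (n : ℕ) → List (Subset n)
allSubsets zero = [] ∷ []
allSubsets (suc n) = map (true ∷_) (allSubsets n) ++ map (false ∷_) (allSubsets n)

isCliqueᵇ : ∀ {n} → Graph n → Subset n → Bool
isCliqueᵇ {n} G S =
  and (concatMap (λ i → map (λ j →
         if (lookup S i ∧ lookup S j ∧ not (i =ᶠ j)) then adj G i j else true)
       (allFin n)) (allFin n))

NK : ∀ {n} → Graph n → ℕ → ℕ
NK {n} G r = length (filterᵇ (λ S → (∣ S ∣ ≡ᵇ r) ∧ isCliqueᵇ G S) (allSubsets n))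

multipartite : ∀ {n} → (Fin n → ℕ) → Graph n
multipartite {n} p = record
  { adj = λ i j → not (p i ≡ᵇ p j)
  ; sym = λ i j → symHelp (p i) (p j)
  ; irrefl = λ i → reflHelp (p i) }
  where
  symHelp : ∀ a b → not (a ≡ᵇ b) ≡ not (b ≡ᵇ a)
  symHelp zero zero = _≡_.refl
  symHelp zero (suc b) = _≡_.refl
  symHelp (suc a) zero = _≡_.refl
  symHelp (suc a) (suc b) = symHelp a b
  reflHelp : ∀ a → not (a ≡ᵇ a) ≡ false
  reflHelp zero = _≡_.refl
  reflHelp (suc a) = reflHelp a

-- i mod k, with the (unused) convention i mod 0 = 0
modP : ℕ → ℕ → ℕ
modP i zero = 0
modP i (suc k) = i % suc k

-- Turán graph T_k(m): vertex i lies in part (i mod k); parts as equal as possible.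
Turan : (k m : ℕ) → Graph m
Turan k m = multipartite (λ i → modP (toℕ i) k)

-- G_k(n,s): vertices 0..s-1 form T_{k-1}(s) (part 1 + (i mod (k-1))),
-- vertices s..n-1 form the independent part 0; complete k-partite.
Gk : (k n s : ℕ) → Graph n
Gk k n s = multipartite (λ i → if toℕ i <ᵇ s then suc (modP (toℕ i) (k ∸ 1)) else 0)

Kg : (m : ℕ) → Graph m
Kg m = record
  { adj = λ i j → not (i =ᶠ j)
  ; sym = λ i j → h (toℕ i) (toℕ j)
  ; irrefl = λ i → r (toℕ i) }
  where
  h : ∀ a b → not (a ≡ᵇ b) ≡ not (b ≡ᵇ a)
  h zero zero = _≡_.refl
  h zero (suc b) = _≡_.refl
  h (suc a) zero = _≡_.refl
  h (suc a) (suc b) = h a b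
  r : ∀ a → not (a ≡ᵇ a) ≡ false
  r zero = _≡_.refl
  r (suc a) = r a

Mg : (m : ℕ) → Graph (2 * m)
Mg m = record
  { adj = λ i j → ((toℕ i / 2) ≡ᵇ (toℕ j / 2)) ∧ not (i =ᶠ j)
  ; sym = λ i j → s (toℕ i) (toℕ j)
  ; irrefl = λ i → r (toℕ i) }
  where
  e : ∀ a b → (a ≡ᵇ b) ≡ (b ≡ᵇ a)
  e zero zero = _≡_.refl
  e zero (suc b) = _≡_.refl
  e (suc a) zero = _≡_.refl
  e (suc a) (suc b) = e a b
  s : ∀ a b → ((a / 2) ≡ᵇ (b / 2)) ∧ not (a ≡ᵇ b) ≡ ((b / 2) ≡ᵇ (a / 2)) ∧ not (b ≡ᵇ a)
  s a b rewrite e (a / 2) (b / 2) | e a b = _≡_.refl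
  r : ∀ a → ((a / 2) ≡ᵇ (a / 2)) ∧ not (a ≡ᵇ a) ≡ false
  r a with (a / 2) ≡ᵇ (a / 2)
  ... | false = _≡_.refl
  ... | true = r' a
    where
    r' : ∀ a → not (a ≡ᵇ a) ≡ false
    r' zero = _≡_.refl
    r' (suc a) = r' a

Free : ∀ {n} → ℕ → ℕ → Graph n → Set
Free k s G = (Kg (suc k) ⊆ᴳ G → ⊥') × (Mg (suc s) ⊆ᴳ G → ⊥')
  where open import Data.Empty renaming (⊥ to ⊥')

ExEq : (n r k s v : ℕ) → Set
ExEq n r k s v =
  (Σ (Graph n) λ G → Free k s G × NK G r ≡ v) ×
  (∀ (G : Graph n) → Free k s G → NK G r Data.Nat.≤ v)

{-# OPTIONS --safe #-}
module Submission where

-- Cliques are counted in lists of vertices of G. Repeating a vertex v in a list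
-- adds a non-adjacent copy of v, so a list is a blow-up of an induced subgraph of
-- G and is again K_{k+1}-free.
--
-- By Tutte–Berge there are B and components C of G − B with ∣B∣ + Σ ⌊∣C∣/2⌋ ≤ s.
-- Let g be the largest number of r-cliques formed by one vertex d ∉ B with B, and
-- δ the largest number formed by one vertex v ∈ C with C ∪ B, attained in C = D.
-- Counting vertex degrees shows that a component contributes at most
-- 2 ⌊∣C∣/2⌋ δ, plus g if ∣C∣ is odd. Write b = ∣B∣ and n = 2s + 1 + t.
-- If (b + t) g ≤ b δ, then D ∪ B with copies of v added up to 2s + 1 vertices has
-- at least as many r-cliques as G. Otherwise B with s − b copies of its best
-- vertex and n − s copies of d does; here r ≥ 3 provides, by double counting, a
-- vertex of B lying in at least 2g/b of the g cliques at d.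
--
-- Zykov symmetrisation at a vertex of maximum degree bounds the clique count of
-- a K_{k+1}-free list by that of a complete k-partite graph, in which all copies
-- of d share a part; balancing the parts gives T_k(2s+1) and G_k(n,s).
--
-- For Tutte–Berge, vertices covered by all maximum matchings are moved into B one
-- by one. When none is left, "no maximum matching misses both u and v" is an
-- equivalence relation (Gallai), and its classes are the components.

open import Defs hiding (sym)
open import Data.Bool using (Bool; true; false; not; _∧_; if_then_else_; T)
open import Data.Bool.ListAction using (and)
import Data.Bool.Properties as Bool
open import Data.Empty using (⊥-elim)
open import Data.Fin using (Fin; toℕ; zero; suc; fromℕ<; inject≤)
open import Data.Fin.Permutation.Components using (transpose)
open import Data.Fin.Properties using (_≟_; any?; all?; toℕ-injective; toℕ<n; toℕ-fromℕ<; fromℕ<-cong; inject≤-injective; pigeonhole) renaming (suc-injective to suc-injectiveᶠ)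
open import Data.Fin.Subset using (Subset; ∣_∣)
open import Data.List as List using (List; []; _∷_; _++_; map; concat; length; filterᵇ; replicate; allFin; upTo)
open import Data.List.Membership.Propositional using (_∈_)
open import Data.List.Membership.Propositional.Properties using (∈-filter⁺; ∈-filter⁻; ∈-++⁻; ∈-∃++; ∈-map⁺; ∈-map⁻; ∈-allFin; ∈-upTo⁺; ∈-upTo⁻; ∈-concat⁺′; ∈-concat⁻′; ∉[]; ∈-lookup)
open import Data.List.Membership.Propositional.Properties.WithK using (unique∧set⇒bag)
open import Data.List.Properties using (filter-++; length-++; length-replicate; length-map; length-filter; length-tabulate; length-upTo; map-cong; map-id; map-++; map-∘; map-tabulate; ++-assoc; ++-identityʳ)
open import Data.List.Relation.Binary.BagAndSetEquality using (∼bag⇒↭)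
open import Data.List.Relation.Binary.Permutation.Propositional using (_↭_; prep; swap; refl; ↭-sym; ↭-trans; ↭-refl; ↭-reflexive) renaming (trans to _⟫_)
open import Data.List.Relation.Binary.Permutation.Propositional.Properties as Perm using (shift; ∈-resp-↭; ↭-length; filter-↭)
open import Data.List.Relation.Binary.Sublist.Propositional using (_⊆_; []; _∷_; _∷ʳ_; ⊆-refl; ⊆-trans) renaming (lookup to ⊆-lookup)
open import Data.List.Relation.Binary.Sublist.Propositional.Properties using (++⁺ˡ; ++⁺ʳ; filter⁺; filter-⊆; length-mono-≤; All-resp-⊆)
open import Data.List.Relation.Unary.All as All using (All; []; _∷_)
open import Data.List.Relation.Unary.AllPairs using (AllPairs; []; _∷_)
open import Data.List.Relation.Unary.Any using (here; there)
open import Data.List.Relation.Unary.Unique.Propositional using (Unique)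
open import Data.List.Relation.Unary.Unique.Propositional.Properties using (allFin⁺; upTo⁺) renaming (map⁺ to Unique-map⁺; filter⁺ to Unique-filter⁺)
open import Data.Nat using (ℕ; zero; suc; _+_; _*_; _∸_; _⊔_; _/_; _%_; ⌊_/2⌋; _≡ᵇ_; _<ᵇ_; _≤_; _<_; z≤n; s≤s; s≤s⁻¹; _≤?_)
open import Data.Nat.Divisibility using (divides)
open import Data.Nat.DivMod using (m≡m%n+[m/n]*n; m%n<n; m<n⇒m%n≡m; [m+kn]%n≡m%n; m<n*o⇒m/o<n; m*n/n≡m; +-distrib-/-∣ʳ)
open import Data.Nat.ListAction using (sum)
open import Data.Nat.ListAction.Properties using (sum-++; sum-↭)
open import Data.Nat.Properties hiding (_≟_)
open import Data.Nat.Tactic.RingSolver using (solve-∀)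
open import Data.Product using (Σ; ∃; ∃₂; _×_; _,_; proj₁; proj₂)
open import Data.Sum using (_⊎_; inj₁; inj₂)
open import Data.Vec using (Vec; []; _∷_; lookup; tabulate)
open import Data.Vec.Properties using (lookup∘tabulate)
open import Function using (_∘_; id; const; Equivalence; mk⇔)
open import Relation.Binary.Definitions using (tri<; tri≈; tri>)
open import Relation.Binary.PropositionalEquality using (_≡_; _≢_; _≗_; refl; sym; trans; cong; cong₂; subst; subst₂; module ≡-Reasoning)
open import Relation.Nullary using (¬_; Dec; yes; no; contradiction; does)
open import Relation.Nullary.Decidable using (T?; dec-true; dec-false; map′; decidable-stable; _×-dec_; _→-dec_; _⊎-dec_; ¬?)

-- Blowing up preserves K_{k+1}-freeness but not the matching bound. So the latter is used once, to
-- get the decomposition, and afterwards survives only as numbers: a comparison list has 2s + 1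
-- vertices, or it has n vertices of which n - s are copies of one vertex. The threshold comes from
-- counting vertices. With a = Σ ⌊∣C∣/2⌋ and u = s - b - a there are b + t + 1 + 2u odd components.
-- Filling D ∪ B up to 2s + 1 vertices creates, besides the copies of v that replace matched pairs,
-- b + 2u copies, and one more if ∣D∣ is even. As g ≤ δ, the only exchange that can fail is that of
-- b + t shares g for b copies worth δ. If it fails, δ < (b + t) g / b; with h ≥ 2g / b for the
-- cliques through both d and the best vertex of B, this gives 2δ ≤ (b + t) h. Hence each added copy
-- of that vertex, joined to n - s ≥ b + t copies of d, pays for a whole matched pair. Cliques are
-- weighted by a function `w` of their size because absorbing an independent class of p vertices
-- joined to everything turns `w j` into `w j + p * w (suc j)`; the inductions therefore run over
-- all weights at once.

private variable
  A : Set

-- Boolean filters, maxima and sums over lists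

true≢false : true ≢ false
true≢false ()

∈-filterᵇ⁺ : ∀ (p : A → Bool) {x xs} → x ∈ xs → p x ≡ true → x ∈ filterᵇ p xs
∈-filterᵇ⁺ p x∈ px = ∈-filter⁺ (T? ∘ p) x∈ (subst T (sym px) _)

∈-filterᵇ⁻ : ∀ (p : A → Bool) {x xs} → x ∈ filterᵇ p xs → x ∈ xs × p x ≡ true
∈-filterᵇ⁻ p {xs = xs} x∈ with ∈-filter⁻ (T? ∘ p) {xs = xs} x∈
... | x∈xs , t = x∈xs , Equivalence.to Bool.T-≡ t

filterᵇ-∘ : ∀ (p q : A → Bool) xs → filterᵇ p (filterᵇ q xs) ≡ filterᵇ (λ x → p x ∧ q x) xs
filterᵇ-∘ p q [] = refl
filterᵇ-∘ p q (x ∷ xs) with q x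
... | false with p x
...   | true = filterᵇ-∘ p q xs
...   | false = filterᵇ-∘ p q xs
filterᵇ-∘ p q (x ∷ xs) | true with p x
...   | true = cong (x ∷_) (filterᵇ-∘ p q xs)
...   | false = filterᵇ-∘ p q xs

filterᵇ-cong : ∀ {p q : A → Bool} → p ≗ q → ∀ xs → filterᵇ p xs ≡ filterᵇ q xs
filterᵇ-cong p≗q [] = refl
filterᵇ-cong {p = p} {q} p≗q (x ∷ xs) rewrite p≗q x with q x
... | true = cong (x ∷_) (filterᵇ-cong p≗q xs)
... | false = filterᵇ-cong p≗q xs

filterᵇ-comm : ∀ (p q : A → Bool) xs → filterᵇ p (filterᵇ q xs) ≡ filterᵇ q (filterᵇ p xs)
filterᵇ-comm p q xs = trans (filterᵇ-∘ p q xs)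
  (trans (filterᵇ-cong (λ x → Bool.∧-comm (p x) (q x)) xs) (sym (filterᵇ-∘ q p xs)))

filterᵇ-none : ∀ (p : A → Bool) xs → (∀ {x} → x ∈ xs → p x ≡ false) → filterᵇ p xs ≡ []
filterᵇ-none p [] h = refl
filterᵇ-none p (x ∷ xs) h rewrite h (here refl) = filterᵇ-none p xs (h ∘ there)

filterᵇ-all : ∀ (p : A → Bool) xs → (∀ {x} → x ∈ xs → p x ≡ true) → filterᵇ p xs ≡ xs
filterᵇ-all p [] h = refl
filterᵇ-all p (x ∷ xs) h rewrite h (here refl) = cong (x ∷_) (filterᵇ-all p xs (h ∘ there))

filterᵇ-split : ∀ (p : A → Bool) xs → filterᵇ (not ∘ p) xs ++ filterᵇ p xs ↭ xs
filterᵇ-split p [] = refl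
filterᵇ-split p (x ∷ xs) with p x
... | true = ↭-trans (shift x (filterᵇ (not ∘ p) xs) (filterᵇ p xs)) (prep x (filterᵇ-split p xs))
... | false = prep x (filterᵇ-split p xs)

argmax : ∀ (f : A → ℕ) xs → xs ≢ [] → ∃ λ v → v ∈ xs × (∀ {u} → u ∈ xs → f u ≤ f v)
argmax f [] ne = ⊥-elim (ne refl)
argmax f (x ∷ []) ne = x , here refl , λ { (here refl) → ≤-refl }
argmax f (x ∷ xs@(_ ∷ _)) ne with argmax f xs (λ ())
... | v , v∈ , max with ≤-total (f x) (f v)
...   | inj₁ x≤v = v , there v∈ , λ { (here refl) → x≤v ; (there u∈) → max u∈ }
...   | inj₂ v≤x = x , here refl , λ { (here refl) → ≤-refl ; (there u∈) → ≤-trans (max u∈) v≤x }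

sum-map-mono : ∀ {f g : A → ℕ} xs → (∀ {x} → x ∈ xs → f x ≤ g x) → sum (map f xs) ≤ sum (map g xs)
sum-map-mono [] h = z≤n
sum-map-mono (x ∷ xs) h = +-mono-≤ (h (here refl)) (sum-map-mono xs (h ∘ there))

sum-map-≤* : ∀ {f : A → ℕ} {c} xs → (∀ {x} → x ∈ xs → f x ≤ c) → sum (map f xs) ≤ length xs * c
sum-map-≤* [] h = z≤n
sum-map-≤* (x ∷ xs) h = +-mono-≤ (h (here refl)) (sum-map-≤* xs (h ∘ there))

-- Weighted clique sums

module Cliques {A : Set} (adj : A → A → Bool) (adj-sym : ∀ x y → adj x y ≡ adj y x) where

  N : A → List A → List A
  N v = filterᵇ (adj v)

  -- The sum of w ∣K∣ over the cliques K of xs all of whose members satisfy P;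
  -- entries of xs count with multiplicity.
  Φ∣ : (ℕ → ℕ) → (A → Bool) → List A → ℕ
  Φ∣ w P [] = w 0
  Φ∣ w P (x ∷ xs) = Φ∣ w P xs + (if P x then Φ∣ (w ∘ suc) (λ y → P y ∧ adj x y) xs else 0)

  Φ : (ℕ → ℕ) → List A → ℕ
  Φ w = Φ∣ w (const true)

  Φ∣-cong : ∀ {w u P Q} → w ≗ u → P ≗ Q → ∀ xs → Φ∣ w P xs ≡ Φ∣ u Q xs
  Φ∣-cong w≗u P≗Q [] = w≗u 0
  Φ∣-cong {Q = Q} w≗u P≗Q (x ∷ xs) rewrite P≗Q x with Q x
  ... | true = cong₂ _+_ (Φ∣-cong w≗u P≗Q xs) (Φ∣-cong (w≗u ∘ suc) (λ y → cong (_∧ adj x y) (P≗Q y)) xs)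
  ... | false = cong (_+ 0) (Φ∣-cong w≗u P≗Q xs)

  Φ∣-filter : ∀ w P Q xs → Φ∣ w (λ y → P y ∧ Q y) xs ≡ Φ∣ w Q (filterᵇ P xs)
  Φ∣-filter w P Q [] = refl
  Φ∣-filter w P Q (x ∷ xs) with P x
  ... | false = trans (+-identityʳ _) (Φ∣-filter w P Q xs)
  ... | true with Q x
  ...   | false = cong (_+ 0) (Φ∣-filter w P Q xs)
  ...   | true = cong₂ _+_ (Φ∣-filter w P Q xs)
            (trans (Φ∣-cong (λ _ → refl) (λ y → Bool.∧-assoc (P y) (Q y) (adj x y)) xs)
                   (Φ∣-filter (w ∘ suc) P (λ y → Q y ∧ adj x y) xs))

  -- The predicate carried by `Φ∣` keeps its recursion structural in the list; here it is traded for
  -- the neighbourhood of `x`, the form in which all later arguments use the recursion.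
  Φ-∷ : ∀ w x xs → Φ w (x ∷ xs) ≡ Φ w xs + Φ (w ∘ suc) (N x xs)
  Φ-∷ w x xs = cong (Φ w xs +_)
    (trans (Φ∣-cong (λ _ → refl) (λ y → Bool.∧-comm true (adj x y)) xs) (Φ∣-filter (w ∘ suc) (adj x) (const true) xs))

  Φ∣-↭ : ∀ w P {xs ys} → xs ↭ ys → Φ∣ w P xs ≡ Φ∣ w P ys
  Φ∣-↭ w P refl = refl
  Φ∣-↭ w P (p ⟫ q) = trans (Φ∣-↭ w P p) (Φ∣-↭ w P q)
  Φ∣-↭ w P (prep x p) with P x
  ... | true = cong₂ _+_ (Φ∣-↭ w P p) (Φ∣-↭ (w ∘ suc) _ p)
  ... | false = cong (_+ 0) (Φ∣-↭ w P p)
  Φ∣-↭ w P (swap {xs} {ys} x y p) with P x | P y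
  ... | false | false = cong (λ z → z + 0 + 0) (Φ∣-↭ w P p)
  ... | false | true = trans (+-identityʳ _)
        (cong₂ _+_ (trans (Φ∣-↭ w P p) (sym (+-identityʳ _))) (trans (Φ∣-↭ (w ∘ suc) _ p) (sym (+-identityʳ _))))
  ... | true | false = trans (cong₂ _+_ (trans (+-identityʳ _) (Φ∣-↭ w P p)) (trans (+-identityʳ _) (Φ∣-↭ (w ∘ suc) _ p)))
        (sym (+-identityʳ _))
  ... | true | true rewrite adj-sym y x with adj x y
  ...   | false rewrite Φ∣-↭ w P p | Φ∣-↭ (w ∘ suc) (λ z → P z ∧ adj x z) p | Φ∣-↭ (w ∘ suc) (λ z → P z ∧ adj y z) p
           = ring₁ (Φ∣ w P ys) _ _
    where
    ring₁ : ∀ a b c → a + b + (c + 0) ≡ a + c + (b + 0)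
    ring₁ = solve-∀
  ...   | true rewrite Φ∣-↭ w P p | Φ∣-↭ (w ∘ suc) (λ z → P z ∧ adj x z) p | Φ∣-↭ (w ∘ suc) (λ z → P z ∧ adj y z) p
                    | Φ∣-↭ (λ j → w (suc (suc j))) (λ z → (P z ∧ adj x z) ∧ adj y z) p
                    | Φ∣-cong {λ j → w (suc (suc j))} (λ _ → refl) (λ z → trans (Bool.∧-assoc (P z) (adj x z) (adj y z))
                        (trans (cong (P z ∧_) (Bool.∧-comm (adj x z) (adj y z))) (sym (Bool.∧-assoc (P z) (adj y z) (adj x z))))) ys
           = ring₂ (Φ∣ w P ys) _ _ _
    where
    ring₂ : ∀ a b c d → a + b + (c + d) ≡ a + c + (b + d)
    ring₂ = solve-∀

  Φ-↭ : ∀ w {xs ys} → xs ↭ ys → Φ w xs ≡ Φ w ys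
  Φ-↭ w = Φ∣-↭ w (const true)

  Φ∣-mono : ∀ w P {xs ys} → xs ⊆ ys → Φ∣ w P xs ≤ Φ∣ w P ys
  Φ∣-mono w P [] = ≤-refl
  Φ∣-mono w P (y ∷ʳ s) = ≤-trans (Φ∣-mono w P s) (m≤m+n _ _)
  Φ∣-mono w P (_∷_ {x} refl s) with P x
  ... | true = +-mono-≤ (Φ∣-mono w P s) (Φ∣-mono (w ∘ suc) _ s)
  ... | false = +-monoˡ-≤ 0 (Φ∣-mono w P s)

  Φ-mono : ∀ w {xs ys} → xs ⊆ ys → Φ w xs ≤ Φ w ys
  Φ-mono w = Φ∣-mono w (const true)

  N-mono : ∀ v {xs ys} → xs ⊆ ys → N v xs ⊆ N v ys
  N-mono v = filter⁺ (T? ∘ adj v) (T? ∘ adj v) (λ { refl p → p })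

  N-++ : ∀ v xs ys → N v (xs ++ ys) ≡ N v xs ++ N v ys
  N-++ v = filter-++ (T? ∘ adj v)

  -- Used with `u = w ∘ suc`: a clique can be left alone or extended by one of `p` independent
  -- vertices joined to everything. Such a class thereby disappears from the list and lives on in
  -- the weight.
  Φ∣-linear : ∀ w u p P xs → Φ∣ (λ j → w j + p * u j) P xs ≡ Φ∣ w P xs + p * Φ∣ u P xs
  Φ∣-linear w u p P [] = refl
  Φ∣-linear w u p P (x ∷ xs) with P x
  ... | false rewrite Φ∣-linear w u p P xs = ring₁ (Φ∣ w P xs) p _
    where
    ring₁ : ∀ a p b → a + p * b + 0 ≡ a + 0 + p * (b + 0)
    ring₁ = solve-∀
  ... | true rewrite Φ∣-linear w u p P xs | Φ∣-linear (w ∘ suc) (u ∘ suc) p (λ y → P y ∧ adj x y) xs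
    = ring₂ (Φ∣ w P xs) p _ _ _
    where
    ring₂ : ∀ a p b c d → a + p * b + (c + p * d) ≡ a + c + p * (b + d)
    ring₂ = solve-∀

  deg : (ℕ → ℕ) → List A → A → ℕ
  deg w xs v = Φ (w ∘ suc) (N v xs)

  deg-mono : ∀ w v {xs ys} → xs ⊆ ys → deg w xs v ≤ deg w ys v
  deg-mono w v s = Φ-mono (w ∘ suc) (N-mono v s)

  -- Each clique meeting `C` is charged to its first vertex in `C`; taking degrees in the larger
  -- list `ys` only overcounts.
  Φ-++-≤ : ∀ w C B {ys} → C ++ B ⊆ ys → Φ w (C ++ B) ≤ Φ w B + sum (map (deg w ys) C)
  Φ-++-≤ w [] B s = m≤m+n _ _
  Φ-++-≤ w (x ∷ C) B {ys} s = begin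
    Φ w (x ∷ C ++ B)                                    ≡⟨ Φ-∷ w x (C ++ B) ⟩
    Φ w (C ++ B) + deg w (C ++ B) x                      ≤⟨ +-mono-≤ (Φ-++-≤ w C B s′) (deg-mono w x s′) ⟩
    Φ w B + sum (map (deg w ys) C) + deg w ys x          ≡⟨ ring₁ (Φ w B) _ _ ⟩
    Φ w B + (deg w ys x + sum (map (deg w ys) C))        ∎
    where
    open ≤-Reasoning
    s′ = ⊆-trans (x ∷ʳ ⊆-refl) s
    ring₁ : ∀ a b c → a + b + c ≡ a + (c + b)
    ring₁ = solve-∀

  -- A clique gained by `v` from the new vertex `u` contains both, so only neighbours of `u` gain,
  -- each by its degree inside the link of `u`.
  deg-∷ : ∀ w u Y C → sum (map (deg w (u ∷ Y)) C) ≡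
    sum (map (deg w Y) C) + sum (map (deg (w ∘ suc) (N u Y)) (N u C))
  deg-∷ w u Y [] = refl
  deg-∷ w u Y (v ∷ C) rewrite adj-sym v u with adj u v
  ... | false rewrite deg-∷ w u Y C = sym (+-assoc (deg w Y v) _ _)
  ... | true rewrite deg-∷ w u Y C | Φ-∷ (w ∘ suc) u (N v Y) | filterᵇ-comm (adj u) (adj v) Y
    = ring₁ (deg w Y v) _ _ _
    where
    ring₁ : ∀ a b c d → a + b + (c + d) ≡ a + c + (b + d)
    ring₁ = solve-∀

  module _ (adj-irrefl : ∀ x → adj x x ≡ false) where

    -- A clique meeting C in one vertex is counted once by each summand, a clique
    -- meeting C in several vertices at least twice by the second one.
    2Φ-++-≤ : ∀ w C B →
      2 * Φ w (C ++ B) ≤ 2 * Φ w B + (sum (map (deg w B) C) + sum (map (deg w (C ++ B)) C))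
    2Φ-++-≤ w [] B = m≤m+n _ _
    2Φ-++-≤ w (u ∷ C) B = begin
      2 * Φ w (u ∷ Y)                                 ≡⟨ cong (2 *_) (Φ-∷ w u Y) ⟩
      2 * (Φ w Y + deg w Y u)                         ≡⟨ ring₁ (Φ w Y) _ ⟩
      2 * Φ w Y + (deg w Y u + deg w Y u)             ≤⟨ +-mono-≤ (2Φ-++-≤ w C B) (+-monoˡ-≤ (deg w Y u) link) ⟩
      2 * Φ w B + (sB + sY) + (deg w B u + sN + deg w Y u)
                                                      ≡⟨ ring₂ (2 * Φ w B) sB sY (deg w B u) sN (deg w Y u) ⟩
      2 * Φ w B + (deg w B u + sB + (deg w Y u + (sY + sN)))
                                                      ≡⟨ cong (λ z → 2 * Φ w B + (deg w B u + sB + z)) (cong₂ _+_ loop (sym (deg-∷ w u Y C))) ⟩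
      2 * Φ w B + (deg w B u + sB + (deg w (u ∷ Y) u + sum (map (deg w (u ∷ Y)) C))) ∎
      where
      open ≤-Reasoning
      Y = C ++ B
      sB = sum (map (deg w B) C)
      sY = sum (map (deg w Y) C)
      sN = sum (map (deg (w ∘ suc) (N u Y)) (N u C))
      loop : deg w Y u ≡ deg w (u ∷ Y) u
      loop rewrite adj-irrefl u = refl
      -- The cliques at `u` must be paid twice, once by the degree of `u` itself. The second payment
      -- comes from `deg w B u` if they have no further vertex in `C`, and otherwise from the degree
      -- that such a vertex gains through `u`.
      link : deg w Y u ≤ deg w B u + sN
      link rewrite N-++ u C B = Φ-++-≤ (w ∘ suc) (N u C) (N u B) ⊆-refl
      ring₁ : ∀ a b → 2 * (a + b) ≡ 2 * a + (b + b)
      ring₁ = solve-∀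
      ring₂ : ∀ a b c d e f → a + (b + c) + (d + e + f) ≡ a + (d + b + (f + (c + e)))
      ring₂ = solve-∀

    Φ-replicate : ∀ w p v xs → Φ w (replicate p v ++ xs) ≡ Φ w xs + p * deg w xs v
    Φ-replicate w zero v xs = sym (+-identityʳ _)
    Φ-replicate w (suc p) v xs = begin
      Φ w (v ∷ replicate p v ++ xs)                               ≡⟨ Φ-∷ w v (replicate p v ++ xs) ⟩
      Φ w (replicate p v ++ xs) + deg w (replicate p v ++ xs) v   ≡⟨ cong₂ _+_ (Φ-replicate w p v xs) (cong (Φ (w ∘ suc)) (N-rep p)) ⟩
      Φ w xs + p * deg w xs v + deg w xs v                        ≡⟨ ring₁ (Φ w xs) _ _ ⟩
      Φ w xs + suc p * deg w xs v                                 ∎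
      where
      open ≡-Reasoning
      N-rep : ∀ p → N v (replicate p v ++ xs) ≡ N v xs
      N-rep zero = refl
      N-rep (suc p) rewrite adj-irrefl v = N-rep p
      ring₁ : ∀ a b c → a + b + c ≡ a + (c + b)
      ring₁ = solve-∀

  -- Inclusion-exclusion: no clique meets both `C` and `Y`, and the cliques inside `B` belong to
  -- both unions. The additive form avoids truncated subtraction.
  Φ-disconnected : ∀ w C Y B → (∀ {x y} → x ∈ C → y ∈ Y → adj x y ≡ false) →
    Φ w (C ++ (Y ++ B)) + Φ w B ≡ Φ w (C ++ B) + Φ w (Y ++ B)
  Φ-disconnected w [] Y B h = +-comm (Φ w (Y ++ B)) _
  Φ-disconnected w (x ∷ C) Y B h = begin
    Φ w (x ∷ C ++ (Y ++ B)) + Φ w B                             ≡⟨ cong (_+ Φ w B) (Φ-∷ w x (C ++ (Y ++ B))) ⟩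
    Φ w (C ++ (Y ++ B)) + deg w (C ++ (Y ++ B)) x + Φ w B       ≡⟨ ring₁ (Φ w (C ++ (Y ++ B))) _ _ ⟩
    Φ w (C ++ (Y ++ B)) + Φ w B + deg w (C ++ (Y ++ B)) x       ≡⟨ cong₂ _+_ (Φ-disconnected w C Y B (h ∘ there)) (cong (Φ (w ∘ suc)) nbrs) ⟩
    Φ w (C ++ B) + Φ w (Y ++ B) + deg w (C ++ B) x              ≡⟨ ring₁ (Φ w (C ++ B)) _ _ ⟩
    Φ w (C ++ B) + deg w (C ++ B) x + Φ w (Y ++ B)              ≡⟨ cong (_+ Φ w (Y ++ B)) (Φ-∷ w x (C ++ B)) ⟨
    Φ w (x ∷ C ++ B) + Φ w (Y ++ B)                             ∎
    where
    open ≡-Reasoning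
    ring₁ : ∀ a b c → a + b + c ≡ a + c + b
    ring₁ = solve-∀
    nbrs : N x (C ++ (Y ++ B)) ≡ N x (C ++ B)
    nbrs rewrite N-++ x C (Y ++ B) | N-++ x Y B | N-++ x C B | filterᵇ-none (adj x) Y (h (here refl)) = refl

  Disconnected : List A → List A → Set
  Disconnected C D = ∀ {x y} → x ∈ C → y ∈ D → adj x y ≡ false

  Φ-components : ∀ w (β : List A → ℕ) B Cs → AllPairs Disconnected Cs →
    (∀ {C} → C ∈ Cs → Φ w (C ++ B) ≤ Φ w B + β C) → Φ w (concat Cs ++ B) ≤ Φ w B + sum (map β Cs)
  -- The component `D` keeps its exact count while all others are estimated by their shares; `β D`
  -- stands on the left in place of a subtraction on the right.
  Φ-components-∈ : ∀ w (β : List A → ℕ) B Cs → AllPairs Disconnected Cs →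
    (∀ {C} → C ∈ Cs → Φ w (C ++ B) ≤ Φ w B + β C) →
    ∀ {D} → D ∈ Cs → Φ w (concat Cs ++ B) + β D ≤ Φ w (D ++ B) + sum (map β Cs)

  private
    concat-∷ : ∀ w B C Cs → All (Disconnected C) Cs →
      Φ w (concat (C ∷ Cs) ++ B) + Φ w B ≡ Φ w (C ++ B) + Φ w (concat Cs ++ B)
    concat-∷ w B C Cs ds rewrite ++-assoc C (concat Cs) B = Φ-disconnected w C (concat Cs) B (go ds)
      where
      go : ∀ {Cs} → All (Disconnected C) Cs → ∀ {x y} → x ∈ C → y ∈ concat Cs → adj x y ≡ false
      go {D ∷ Cs} (d ∷ ds) x∈ y∈ with ∈-++⁻ D y∈
      ... | inj₁ y∈D = d x∈ y∈D
      ... | inj₂ y∈Cs = go ds x∈ y∈Cs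

  Φ-components w β B [] ds h = m≤m+n _ _
  Φ-components w β B (C ∷ Cs) (d ∷ ds) h = +-cancelʳ-≤ (Φ w B) _ _ (begin
    Φ w (concat (C ∷ Cs) ++ B) + Φ w B              ≡⟨ concat-∷ w B C Cs d ⟩
    Φ w (C ++ B) + Φ w (concat Cs ++ B)             ≤⟨ +-mono-≤ (h (here refl)) (Φ-components w β B Cs ds (h ∘ there)) ⟩
    Φ w B + β C + (Φ w B + sum (map β Cs))          ≡⟨ ring₁ (Φ w B) (β C) _ ⟩
    Φ w B + (β C + sum (map β Cs)) + Φ w B          ∎)
    where
    open ≤-Reasoning
    ring₁ : ∀ a b c → a + b + (a + c) ≡ a + (b + c) + a
    ring₁ = solve-∀
  Φ-components-∈ w β B (C ∷ Cs) (d ∷ ds) h (here refl) = +-cancelʳ-≤ (Φ w B) _ _ (begin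
    Φ w (concat (C ∷ Cs) ++ B) + β C + Φ w B        ≡⟨ ring₁ (Φ w (concat (C ∷ Cs) ++ B)) _ _ ⟩
    Φ w (concat (C ∷ Cs) ++ B) + Φ w B + β C        ≡⟨ cong (_+ β C) (concat-∷ w B C Cs d) ⟩
    Φ w (C ++ B) + Φ w (concat Cs ++ B) + β C       ≤⟨ +-monoˡ-≤ (β C) (+-monoʳ-≤ (Φ w (C ++ B)) (Φ-components w β B Cs ds (h ∘ there))) ⟩
    Φ w (C ++ B) + (Φ w B + sum (map β Cs)) + β C   ≡⟨ ring₂ (Φ w (C ++ B)) _ _ _ ⟩
    Φ w (C ++ B) + (β C + sum (map β Cs)) + Φ w B   ∎)
    where
    open ≤-Reasoning
    ring₁ : ∀ a b c → a + b + c ≡ a + c + b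
    ring₁ = solve-∀
    ring₂ : ∀ a b c d → a + (b + c) + d ≡ a + (d + c) + b
    ring₂ = solve-∀
  Φ-components-∈ w β B (C ∷ Cs) (d ∷ ds) h {D} (there D∈) = +-cancelʳ-≤ (Φ w B) _ _ (begin
    Φ w (concat (C ∷ Cs) ++ B) + β D + Φ w B            ≡⟨ ring₁ (Φ w (concat (C ∷ Cs) ++ B)) _ _ ⟩
    Φ w (concat (C ∷ Cs) ++ B) + Φ w B + β D            ≡⟨ cong (_+ β D) (concat-∷ w B C Cs d) ⟩
    Φ w (C ++ B) + Φ w (concat Cs ++ B) + β D           ≡⟨ +-assoc (Φ w (C ++ B)) _ _ ⟩
    Φ w (C ++ B) + (Φ w (concat Cs ++ B) + β D)         ≤⟨ +-mono-≤ (h (here refl)) (Φ-components-∈ w β B Cs ds (h ∘ there) D∈) ⟩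
    Φ w B + β C + (Φ w (D ++ B) + sum (map β Cs))       ≡⟨ ring₂ (Φ w B) _ (Φ w (D ++ B)) _ ⟩
    Φ w (D ++ B) + (β C + sum (map β Cs)) + Φ w B       ∎)
    where
    open ≤-Reasoning
    ring₁ : ∀ a b c → a + b + c ≡ a + c + b
    ring₁ = solve-∀
    ring₂ : ∀ a b c d → a + b + (c + d) ≡ c + (b + d) + a
    ring₂ = solve-∀

-- Complete multipartite bounds

-- The weighted clique sum of the complete multipartite graph with part sizes ps.
E : (ℕ → ℕ) → List ℕ → ℕ
E w [] = w 0
E w (p ∷ ps) = E (λ j → w j + p * w (suc j)) ps

E-cong : ∀ {w u} → w ≗ u → ∀ ps → E w ps ≡ E u ps
E-cong w≗u [] = w≗u 0
E-cong w≗u (p ∷ ps) = E-cong (λ j → cong₂ _+_ (w≗u j) (cong (p *_) (w≗u (suc j)))) ps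

E-linear : ∀ w u p ps → E (λ j → w j + p * u j) ps ≡ E w ps + p * E u ps
E-linear w u p [] = refl
E-linear w u p (q ∷ ps) = trans
  (E-cong (λ j → ring₁ (w j) (u j) (w (suc j)) (u (suc j)) p q) ps)
  (E-linear (λ j → w j + q * w (suc j)) (λ j → u j + q * u (suc j)) p ps)
  where
  ring₁ : ∀ a b c d p q → a + p * b + q * (c + p * d) ≡ a + q * c + p * (b + q * d)
  ring₁ = solve-∀

E-∷ : ∀ w p ps → E w (p ∷ ps) ≡ E w ps + p * E (w ∘ suc) ps
E-∷ w p ps = E-linear w (w ∘ suc) p ps

E-suc : ∀ w p ps → E w (suc p ∷ ps) ≡ E w (p ∷ ps) + E (w ∘ suc) ps
E-suc w p ps rewrite E-∷ w (suc p) ps | E-∷ w p ps = ring₁ (E w ps) _ _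
  where
  ring₁ : ∀ a b c → a + (b + c) ≡ a + c + b
  ring₁ = solve-∀

E-↭ : ∀ w {ps qs} → ps ↭ qs → E w ps ≡ E w qs
E-↭ w refl = refl
E-↭ w (prep p r) = E-↭ _ r
E-↭ w (r ⟫ r′) = trans (E-↭ w r) (E-↭ w r′)
E-↭ w (swap {xs} {ys} p q r) = trans (E-↭ _ r) (E-cong (λ j → ring₁ (w j) (w (suc j)) (w (suc (suc j))) p q) ys)
  where
  ring₁ : ∀ a b c p q → a + p * b + q * (b + p * c) ≡ a + q * b + p * (b + q * c)
  ring₁ = solve-∀

E-head-mono : ∀ w {p q} ps → p ≤ q → E w (p ∷ ps) ≤ E w (q ∷ ps)
E-head-mono w {p} {q} ps p≤q rewrite E-∷ w p ps | E-∷ w q ps = +-monoʳ-≤ (E w ps) (*-monoˡ-≤ _ p≤q)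

w0≤E : ∀ w ps → w 0 ≤ E w ps
w0≤E w [] = ≤-refl
w0≤E w (p ∷ ps) rewrite E-∷ w p ps = ≤-trans (w0≤E w ps) (m≤m+n _ _)

E-zeros : ∀ w ps → (∀ {p} → p ∈ ps → p ≡ 0) → E w ps ≡ w 0
E-zeros w [] h = refl
E-zeros w (p ∷ ps) h rewrite h (here refl) = trans (E-zeros _ ps (h ∘ there)) (+-identityʳ _)

extract : ∀ {A : Set} {x : A} {xs} → x ∈ xs → ∃ λ ys → xs ↭ x ∷ ys
extract {x = x} x∈ with ∈-∃++ x∈
... | ys , zs , refl = ys ++ zs , shift x ys zs

extract-max : ∀ p ps → ∃₂ λ q qs → p ∷ ps ↭ q ∷ qs × (∀ {x} → x ∈ qs → x ≤ q)
extract-max p ps with argmax id (p ∷ ps) (λ ())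
... | q , q∈ , max with extract q∈
...   | qs , r = q , qs , r , λ x∈ → max (∈-resp-↭ (↭-sym r) (there x∈))

sum-≥* : ∀ {c} ps → (∀ {p} → p ∈ ps → c ≤ p) → length ps * c ≤ sum ps
sum-≥* [] h = z≤n
sum-≥* (p ∷ ps) h = +-mono-≤ (h (here refl)) (sum-≥* ps (h ∘ there))

sum-≤* : ∀ {c} ps → (∀ {p} → p ∈ ps → p ≤ c) → sum ps ≤ length ps * c
sum-≤* [] h = z≤n
sum-≤* (p ∷ ps) h = +-mono-≤ (h (here refl)) (sum-≤* ps (h ∘ there))

Balanced : List ℕ → Set
Balanced bs = ∀ {p q} → p ∈ bs → q ∈ bs → p ≤ suc q

Balanced-pred : ∀ {c bs} → (∀ {x} → x ∈ bs → x ≤ suc c) → Balanced (suc c ∷ bs) → Balanced (c ∷ bs)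
Balanced-pred max bal (here refl) (here refl) = n≤1+n _
Balanced-pred max bal (here refl) (there q∈) = ≤-trans (n≤1+n _) (bal (here refl) (there q∈))
Balanced-pred max bal (there p∈) (here refl) = max p∈
Balanced-pred max bal (there p∈) (there q∈) = bal (there p∈) (there q∈)

private
  -- A vertex is removed from a largest part on each side. By `E-suc` this leaves the shortened
  -- lists and the links of the removed vertices, and both pairs satisfy the hypotheses again. The
  -- bound `m` drives the induction because the lists get permuted.
  E-≤-balanced′ : ∀ m w ps bs → sum bs ≤ m → Balanced bs → length ps ≡ length bs → sum ps ≤ sum bs → E w ps ≤ E w bs
  E-≤-balanced′ m w [] [] _ bal len le = ≤-refl
  E-≤-balanced′ m w (p₀ ∷ ps₀) (b₀ ∷ bs₀) sm bal len le with extract-max p₀ ps₀ | extract-max b₀ bs₀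
  ... | zero , ps , rp , pmax | _ = ≤-trans (≤-reflexive (E-zeros w (p₀ ∷ ps₀) zeros)) (w0≤E w (b₀ ∷ bs₀))
    where
    zeros : ∀ {p} → p ∈ p₀ ∷ ps₀ → p ≡ 0
    zeros p∈ with ∈-resp-↭ rp p∈
    ... | here refl = refl
    ... | there p∈′ = n≤0⇒n≡0 (pmax p∈′)
  ... | suc p , ps , rp , pmax | zero , bs , rb , bmax = contradiction
          (≤-trans (≤-reflexive (sym (sum-↭ rp))) (≤-trans le (≤-trans (≤-reflexive (sum-↭ rb)) (sum-≤* bs bmax))))
          (λ h → n≮0 (≤-trans h (≤-reflexive (*-zeroʳ (length bs)))))
  E-≤-balanced′ zero w (p₀ ∷ ps₀) (b₀ ∷ bs₀) sm bal len le | suc p , ps , rp , pmax | suc c , bs , rb , bmax =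
    contradiction (≤-trans (≤-reflexive (sym (sum-↭ rb))) sm) n≮0
  E-≤-balanced′ (suc m) w (p₀ ∷ ps₀) (b₀ ∷ bs₀) sm bal len le | suc p , ps , rp , pmax | suc c , bs , rb , bmax = begin
    E w (p₀ ∷ ps₀)                          ≡⟨ E-↭ w rp ⟩
    E w (suc p ∷ ps)                        ≡⟨ E-suc w p ps ⟩
    E w (p ∷ ps) + E (w ∘ suc) ps           ≤⟨ +-mono-≤
      (E-≤-balanced′ m w (p ∷ ps) (c ∷ bs) (s≤s⁻¹ sm′) (Balanced-pred bmax bal′) (cong suc len′) (s≤s⁻¹ le′))
      (E-≤-balanced′ m (w ∘ suc) ps bs (≤-trans (m≤n+m _ c) (s≤s⁻¹ sm′)) (λ x y → bal′ (there x) (there y)) len′ rest) ⟩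
    E w (c ∷ bs) + E (w ∘ suc) bs           ≡⟨ E-suc w c bs ⟨
    E w (suc c ∷ bs)                        ≡⟨ E-↭ w rb ⟨
    E w (b₀ ∷ bs₀)                          ∎
    where
    open ≤-Reasoning
    bal′ : Balanced (suc c ∷ bs)
    bal′ x∈ y∈ = bal (∈-resp-↭ (↭-sym rb) x∈) (∈-resp-↭ (↭-sym rb) y∈)
    len′ : length ps ≡ length bs
    len′ = suc-injective (trans (sym (↭-length rp)) (trans len (↭-length rb)))
    le′ : suc p + sum ps ≤ suc c + sum bs
    le′ = subst₂ _≤_ (sum-↭ rp) (sum-↭ rb) le
    sm′ : suc c + sum bs ≤ suc m
    sm′ = ≤-trans (≤-reflexive (sym (sum-↭ rb))) sm
    -- If the largest part on the left is below that of the balanced side, then every part on the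
    -- left is at most `c` and every part on the right at least `c`. Otherwise the left side loses
    -- at least as much as the right one.
    rest : sum ps ≤ sum bs
    rest with ≤-<-connex (suc p) c
    ... | inj₁ p≤c = begin
      sum ps               ≤⟨ sum-≤* ps pmax ⟩
      length ps * suc p    ≤⟨ *-monoʳ-≤ (length ps) p≤c ⟩
      length ps * c        ≡⟨ cong (_* c) len′ ⟩
      length bs * c        ≤⟨ sum-≥* bs (λ x∈ → s≤s⁻¹ (bal′ (here refl) (there x∈))) ⟩
      sum bs               ∎
    ... | inj₂ c<p = +-cancelˡ-≤ (suc c) _ _ (≤-trans (+-monoˡ-≤ (sum ps) c<p) le′)

E-≤-balanced : ∀ w ps bs → Balanced bs → length ps ≡ length bs → sum ps ≤ sum bs → E w ps ≤ E w bs
E-≤-balanced w ps bs = E-≤-balanced′ (sum bs) w ps bs ≤-refl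

-- An excess `j` over the prescribed size `q` of the first part does not help. A vertex of the
-- excess is paired with a vertex of a largest part of `bs`: the link of the former avoids the big
-- part, while the link of the latter contains a part of size `q`, which is at least `c`.
E-≤-balanced-with : ∀ w q j ps bs → Balanced bs → (∀ {b} → b ∈ bs → b ≤ q) → length ps ≡ length bs →
  j + sum ps ≤ sum bs → E w (j + q ∷ ps) ≤ E w (q ∷ bs)
E-≤-balanced-with w q zero ps bs bal bs≤q len le = E-≤-balanced (λ i → w i + q * w (suc i)) ps bs bal len le
E-≤-balanced-with w q (suc j) (p₀ ∷ ps) (b₀ ∷ bs₀) bal bs≤q len le with extract-max b₀ bs₀
... | zero , bs , rb , bmax = contradiction
  (≤-trans le (≤-trans (≤-reflexive (sum-↭ rb)) (≤-trans (sum-≤* bs bmax) (≤-reflexive (*-zeroʳ (length bs)))))) n≮0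
... | suc c , bs , rb , bmax = begin
  E w (suc (j + q) ∷ p₀ ∷ ps)                     ≡⟨ E-suc w (j + q) (p₀ ∷ ps) ⟩
  E w (j + q ∷ p₀ ∷ ps) + E (w ∘ suc) (p₀ ∷ ps)   ≤⟨ +-mono-≤
    (E-≤-balanced-with w q j (p₀ ∷ ps) (c ∷ bs) bal′ bs≤q′ len′ le′)
    (≤-trans (E-≤-balanced (w ∘ suc) (p₀ ∷ ps) (c ∷ bs) bal′ len′ (m+n≤o⇒n≤o j le′))
             (E-head-mono (w ∘ suc) bs (bs≤q′ (here refl)))) ⟩
  E w (q ∷ c ∷ bs) + E (w ∘ suc) (q ∷ bs)         ≡⟨ cong (_+ E (w ∘ suc) (q ∷ bs)) (E-↭ w (swap q c (↭-refl {x = bs}))) ⟩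
  E w (c ∷ q ∷ bs) + E (w ∘ suc) (q ∷ bs)         ≡⟨ E-suc w c (q ∷ bs) ⟨
  E w (suc c ∷ q ∷ bs)                            ≡⟨ E-↭ w (swap (suc c) q (↭-refl {x = bs})) ⟩
  E w (q ∷ suc c ∷ bs)                            ≡⟨ E-↭ w (prep q rb) ⟨
  E w (q ∷ b₀ ∷ bs₀)                              ∎
  where
  open ≤-Reasoning
  bal′ : Balanced (c ∷ bs)
  bal′ = Balanced-pred bmax (λ x∈ y∈ → bal (∈-resp-↭ (↭-sym rb) x∈) (∈-resp-↭ (↭-sym rb) y∈))
  bs≤q′ : ∀ {b} → b ∈ c ∷ bs → b ≤ q
  bs≤q′ (here refl) = ≤-trans (n≤1+n _) (bs≤q (∈-resp-↭ (↭-sym rb) (here refl)))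
  bs≤q′ (there b∈) = bs≤q (∈-resp-↭ (↭-sym rb) (there b∈))
  len′ : suc (length ps) ≡ suc (length bs)
  len′ = trans len (↭-length rb)
  le′ : j + sum (p₀ ∷ ps) ≤ c + sum bs
  le′ = s≤s⁻¹ (≤-trans le (≤-reflexive (sum-↭ rb)))

replicate-⊆-filterᵇ : ∀ {A : Set} (p : A → Bool) {d} q {xs} → p d ≡ true → replicate q d ⊆ xs → replicate q d ⊆ filterᵇ p xs
replicate-⊆-filterᵇ p {d} q pd s = subst (_⊆ _) (filterᵇ-all p (replicate q d) (all q))
  (filter⁺ (T? ∘ p) (T? ∘ p) (λ { refl z → z }) s)
  where
  all : ∀ q {x} → x ∈ replicate q d → p x ≡ true
  all (suc q) (here refl) = pd
  all (suc q) (there x∈) = all q x∈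

-- Zykov symmetrisation

module Zykov {A : Set} (adj : A → A → Bool) (adj-sym : ∀ x y → adj x y ≡ adj y x) (adj-irrefl : ∀ x → adj x x ≡ false) where
  open Cliques adj adj-sym

  Clique : List A → Set
  Clique = AllPairs (λ x y → adj x y ≡ true)

  -- Membership rather than inclusion with multiplicity: repeating vertices of `xs` cannot affect
  -- the property, so blow-ups inherit it.
  CliqueFree : ℕ → List A → Set
  CliqueFree k xs = ∀ ks → Clique ks → (∀ {x} → x ∈ ks → x ∈ xs) → length ks ≢ k

  -- Zykov symmetrisation in one step: every non-neighbour of a vertex v of
  -- maximum degree is replaced by a copy of v.
  symmetrise : ∀ w v xs → (∀ {u} → u ∈ xs → deg w xs u ≤ deg w xs v) →
    Φ w xs ≤ Φ (λ j → w j + length (filterᵇ (not ∘ adj v) xs) * w (suc j)) (N v xs)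
  symmetrise w v xs max = begin
    Φ w xs                                    ≡⟨ Φ-↭ w split ⟨
    Φ w (R ++ N v xs)                         ≤⟨ Φ-++-≤ w R (N v xs) ⊆-refl ⟩
    Φ w (N v xs) + sum (map (deg w (R ++ N v xs)) R)
                                              ≤⟨ +-monoʳ-≤ (Φ w (N v xs)) (sum-map-≤* R (λ {u} u∈ →
                                                   ≤-trans (≤-reflexive (deg-↭ u)) (max (proj₁ (∈-filterᵇ⁻ _ u∈))))) ⟩
    Φ w (N v xs) + length R * deg w xs v      ≡⟨ Φ∣-linear w (w ∘ suc) (length R) _ (N v xs) ⟨
    Φ (λ j → w j + length R * w (suc j)) (N v xs) ∎
    where
    open ≤-Reasoning
    R = filterᵇ (not ∘ adj v) xs
    split = filterᵇ-split (adj v) xs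
    deg-↭ : ∀ u → deg w (R ++ N v xs) u ≡ deg w xs u
    deg-↭ u = Φ-↭ (w ∘ suc) (filter-↭ (T? ∘ adj u) split)

  -- Each round turns the non-neighbours of `v` into one part, absorbed by the weight, and leaves
  -- `N v xs` with clique bound lowered by one. All copies of `d` have the same adjacency to `v`, so
  -- they always go to the same side and finally end up in one part.
  zykov : ∀ k w xs → CliqueFree (suc k) xs → ∃ λ ps → length ps ≡ k × sum ps ≡ length xs × Φ w xs ≤ E w ps ×
    (∀ d q → 1 ≤ q → replicate q d ⊆ xs → ∃ λ p → p ∈ ps × q ≤ p)
  zykov zero w [] free = [] , refl , refl , ≤-refl , λ { d (suc q) _ () }
  zykov zero w (x ∷ xs) free = ⊥-elim (free (x ∷ []) ([] ∷ []) (λ { (here refl) → here refl }) refl)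
  zykov (suc k) w [] free = replicate (suc k) 0 , length-replicate (suc k) , sum0 k ,
    ≤-reflexive (sym (E-zeros w (replicate (suc k) 0) (mem0 k))) , λ { d (suc q) _ () }
    where
    sum0 : ∀ k → sum (replicate k 0) ≡ 0
    sum0 zero = refl
    sum0 (suc k) = sum0 k
    mem0 : ∀ k {p} → p ∈ replicate (suc k) 0 → p ≡ 0
    mem0 k (here refl) = refl
    mem0 (suc k) (there p∈) = mem0 k p∈
  zykov (suc k) w xs@(_ ∷ _) free with argmax (deg w xs) xs (λ ())
  ... | v , v∈ , max with zykov k (λ j → w j + length (filterᵇ (not ∘ adj v) xs) * w (suc j)) (N v xs) free′
    where
    free′ : CliqueFree (suc k) (N v xs)
    free′ ks cl sub len = free (v ∷ ks) (All.tabulate (λ x∈ → proj₂ (∈-filterᵇ⁻ (adj v) (sub x∈))) ∷ cl)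
      (λ { (here refl) → v∈ ; (there x∈) → proj₁ (∈-filterᵇ⁻ (adj v) (sub x∈)) }) (cong suc len)
  ... | ps , len , sm , bound , big = length R ∷ ps , cong suc len , sum≡ ,
        ≤-trans (symmetrise w v xs max) bound , big′
    where
    R = filterᵇ (not ∘ adj v) xs
    sum≡ : length R + sum ps ≡ length xs
    sum≡ = trans (cong (length R +_) sm) (trans (sym (length-++ R)) (↭-length (filterᵇ-split (adj v) xs)))
    big′ : ∀ d q → 1 ≤ q → replicate q d ⊆ xs → ∃ λ p → p ∈ length R ∷ ps × q ≤ p
    big′ d q 1≤q s with adj v d in eq
    ... | true with big d q 1≤q (replicate-⊆-filterᵇ (adj v) q eq s)
    ...   | p , p∈ , q≤p = p , there p∈ , q≤p
    big′ d q 1≤q s | false = length R , here refl ,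
      subst (_≤ length R) (length-replicate q) (length-mono-≤ (replicate-⊆-filterᵇ (not ∘ adj v) q (cong not eq) s))

  Φ-≤-balanced : ∀ w xs bs → Balanced bs → CliqueFree (suc (length bs)) xs → length xs ≤ sum bs → Φ w xs ≤ E w bs
  Φ-≤-balanced w xs bs bal free le with zykov (length bs) w xs free
  ... | ps , len , sm , bound , _ = ≤-trans bound (E-≤-balanced w ps bs bal len (≤-trans (≤-reflexive sm) le))

  Φ-≤-balanced-with : ∀ w xs q d bs → 1 ≤ q → Balanced bs → (∀ {b} → b ∈ bs → b ≤ q) →
    CliqueFree (suc (suc (length bs))) xs → length xs ≤ q + sum bs → replicate q d ⊆ xs → Φ w xs ≤ E w (q ∷ bs)
  Φ-≤-balanced-with w xs q d bs 1≤q bal bs≤q free le rep with zykov (suc (length bs)) w xs free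
  ... | ps , len , sm , bound , big with big d q 1≤q rep
  ...   | p , p∈ , q≤p with extract p∈
  ...     | qs , r = begin
    Φ w xs               ≤⟨ bound ⟩
    E w ps               ≡⟨ E-↭ w r ⟩
    E w (p ∷ qs)         ≡⟨ cong (λ z → E w (z ∷ qs)) (m∸n+n≡m q≤p) ⟨
    E w (p ∸ q + q ∷ qs) ≤⟨ E-≤-balanced-with w q (p ∸ q) qs bs bal bs≤q (suc-injective (trans (sym (↭-length r)) len)) le′ ⟩
    E w (q ∷ bs)         ∎
    where
    open ≤-Reasoning
    le′ : p ∸ q + sum qs ≤ sum bs
    le′ = +-cancelˡ-≤ q _ _ (begin
      q + (p ∸ q + sum qs) ≡⟨ +-assoc q _ _ ⟨
      q + (p ∸ q) + sum qs ≡⟨ cong (_+ sum qs) (m+[n∸m]≡n q≤p) ⟩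
      p + sum qs           ≡⟨ sum-↭ r ⟨
      sum ps               ≡⟨ sm ⟩
      length xs            ≤⟨ le ⟩
      q + sum bs           ∎)

-- Counting, permutations and involutions of lists

count : (A → Bool) → List A → ℕ
count p xs = length (filterᵇ p xs)

count-mono : ∀ {p q : A → Bool} xs → (∀ {x} → x ∈ xs → p x ≡ true → q x ≡ true) → count p xs ≤ count q xs
count-mono [] h = z≤n
count-mono {p = p} {q} (x ∷ xs) h with p x in px | q x in qx
... | false | false = count-mono xs (h ∘ there)
... | false | true = m≤n⇒m≤1+n (count-mono xs (h ∘ there))
... | true | true = s≤s (count-mono xs (h ∘ there))
... | true | false = contradiction (trans (sym (h (here refl) px)) qx) true≢false

count-strict : ∀ {p q : A → Bool} xs → (∀ {x} → x ∈ xs → p x ≡ true → q x ≡ true) →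
  ∀ {y} → y ∈ xs → p y ≡ false → q y ≡ true → count p xs < count q xs
count-strict (x ∷ xs) h (here refl) py qy rewrite py | qy = s≤s (count-mono xs (h ∘ there))
count-strict {p = p} {q} (x ∷ xs) h (there y∈) py qy with p x in px | q x in qx
... | false | false = count-strict xs (h ∘ there) y∈ py qy
... | false | true = m≤n⇒m≤1+n (count-strict xs (h ∘ there) y∈ py qy)
... | true | true = s≤s (count-strict xs (h ∘ there) y∈ py qy)
... | true | false = contradiction (trans (sym (h (here refl) px)) qx) true≢false

count-map : ∀ {B : Set} (p : B → Bool) (f : A → B) xs → count p (map f xs) ≡ count (p ∘ f) xs
count-map p f [] = refl
count-map p f (x ∷ xs) with p (f x)
... | true = cong suc (count-map p f xs)
... | false = count-map p f xs

count-↭ : ∀ (p : A → Bool) {xs ys} → xs ↭ ys → count p xs ≡ count p ys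
count-↭ p r = ↭-length (filter-↭ (T? ∘ p) r)

count-++ : ∀ (p : A → Bool) xs ys → count p (xs ++ ys) ≡ count p xs + count p ys
count-++ p xs ys = trans (cong length (filter-++ (T? ∘ p) xs ys)) (length-++ (filterᵇ p xs))

count-concat : ∀ (p : A → Bool) xss → count p (concat xss) ≡ sum (map (count p) xss)
count-concat p [] = refl
count-concat p (xs ∷ xss) = trans (count-++ p xs (concat xss)) (cong (count p xs +_) (count-concat p xss))

count-≤1 : ∀ (p : A → Bool) {xs} → Unique xs →
  (∀ {x y} → x ∈ xs → y ∈ xs → p x ≡ true → p y ≡ true → x ≡ y) → count p xs ≤ 1
count-≤1 p {xs} uniq h with filterᵇ p xs in eq | Unique-filter⁺ (T? ∘ p) uniq
... | [] | _ = z≤n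
... | _ ∷ [] | _ = s≤s z≤n
... | x ∷ y ∷ zs | (x≢y ∷ _) ∷ _ = contradiction (h (proj₁ x∈) (proj₁ y∈) (proj₂ x∈) (proj₂ y∈)) x≢y
  where
  x∈ : x ∈ xs × p x ≡ true
  x∈ = ∈-filterᵇ⁻ p (subst (x ∈_) (sym eq) (here refl))
  y∈ : y ∈ xs × p y ≡ true
  y∈ = ∈-filterᵇ⁻ p (subst (y ∈_) (sym eq) (there (here refl)))

unique-↭ : ∀ {xs ys : List A} → Unique xs → Unique ys →
  (∀ {x} → x ∈ xs → x ∈ ys) → (∀ {x} → x ∈ ys → x ∈ xs) → xs ↭ ys
unique-↭ ux uy to from = ∼bag⇒↭ (unique∧set⇒bag ux uy (mk⇔ to from))

Unique-resp-⊆ : ∀ {xs ys : List A} → xs ⊆ ys → Unique ys → Unique xs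
Unique-resp-⊆ [] [] = []
Unique-resp-⊆ (y ∷ʳ s) (_ ∷ u) = Unique-resp-⊆ s u
Unique-resp-⊆ (refl ∷ s) (n ∷ u) = All-resp-⊆ s n ∷ Unique-resp-⊆ s u

involution-↭ : ∀ (f : A → A) → (∀ x → f (f x) ≡ x) → ∀ {xs} → Unique xs →
  (∀ {x} → x ∈ xs → f x ∈ xs) → map f xs ↭ xs
involution-↭ f inv {xs} uniq closed = unique-↭ (Unique-map⁺ inj uniq) uniq to from
  where
  inj : ∀ {x y} → f x ≡ f y → x ≡ y
  inj eq = trans (sym (inv _)) (trans (cong f eq) (inv _))
  to : ∀ {x} → x ∈ map f xs → x ∈ xs
  to x∈ with ∈-map⁻ f x∈
  ... | y , y∈ , refl = closed y∈
  from : ∀ {x} → x ∈ xs → x ∈ map f xs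
  from {x} x∈ = subst (_∈ map f xs) (inv x) (∈-map⁺ f (closed x∈))

count-involution : ∀ (p : A → Bool) (f : A → A) → (∀ x → f (f x) ≡ x) → ∀ {xs} → Unique xs →
  (∀ {x} → x ∈ xs → f x ∈ xs) → count (p ∘ f) xs ≡ count p xs
count-involution p f inv {xs} uniq closed = trans (sym (count-map p f xs)) (count-↭ p (involution-↭ f inv uniq closed))

-- Equivalence classes

module _ (_~_ : A → A → Set) (_~?_ : ∀ x y → Dec (x ~ y)) (~-refl : ∀ {x} → x ~ x)
  (~-sym : ∀ {x y} → x ~ y → y ~ x) (~-trans : ∀ {x y z} → x ~ y → y ~ z → x ~ z) where

  record IsClass (xs C : List A) : Set where
    field
      sublist : C ⊆ xs
      related : ∀ {x y} → x ∈ C → y ∈ C → x ~ y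
      closed  : ∀ {x y} → x ∈ C → y ∈ xs → x ~ y → y ∈ C

  Classes : List A → Set
  Classes xs = ∃ λ Cs → concat Cs ↭ xs × AllPairs (λ C D → ∀ {x y} → x ∈ C → y ∈ D → ¬ x ~ y) Cs ×
    (∀ {C} → C ∈ Cs → IsClass xs C)

  private
    classes′ : ∀ m xs → length xs ≤ m → Classes xs
    classes′ m [] _ = [] , refl , [] , λ ()
    classes′ (suc m) (x ∷ xs) (s≤s len) with classes′ m (filterᵇ (λ y → not (does (x ~? y))) xs) (≤-trans (length-filter _ xs) len)
    ... | Cs , perm , sep , cls = (C₀ ∷ Cs) , perm′ , sep₀ ∷ sep , cls′
      where
      near far : A → Bool
      near y = does (x ~? y)
      far y = not (near y)
      C₀ = x ∷ filterᵇ near xs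
      near⁻ : ∀ {y} → y ∈ C₀ → x ~ y
      near⁻ (here refl) = ~-refl
      near⁻ {y} (there y∈) with x ~? y | proj₂ (∈-filterᵇ⁻ near {xs = xs} y∈)
      ... | yes r | _ = r
      far⁻ : ∀ {y} → y ∈ filterᵇ far xs → ¬ x ~ y
      far⁻ {y} y∈ with x ~? y | proj₂ (∈-filterᵇ⁻ far {xs = xs} y∈)
      ... | no r | _ = r
      perm′ : concat (C₀ ∷ Cs) ↭ x ∷ xs
      perm′ = prep x (↭-trans (Perm.++⁺ˡ (filterᵇ near xs) perm)
        (↭-trans (Perm.++-comm (filterᵇ near xs) (filterᵇ far xs)) (filterᵇ-split near xs)))
      C⊆far : ∀ {C y} → C ∈ Cs → y ∈ C → y ∈ filterᵇ far xs
      C⊆far C∈ y∈ = ⊆-lookup (IsClass.sublist (cls C∈)) y∈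
      sep₀ : All (λ D → ∀ {y z} → y ∈ C₀ → z ∈ D → ¬ y ~ z) Cs
      sep₀ = All.tabulate (λ D∈ y∈ z∈ r → far⁻ (C⊆far D∈ z∈) (~-trans (near⁻ y∈) r))
      cls′ : ∀ {C} → C ∈ C₀ ∷ Cs → IsClass (x ∷ xs) C
      cls′ (here refl) = record
        { sublist = refl ∷ filter-⊆ (T? ∘ near) xs
        ; related = λ y∈ z∈ → ~-trans (~-sym (near⁻ y∈)) (near⁻ z∈)
        ; closed = λ { _ (here refl) _ → here refl
                     ; y∈ (there z∈) r → there (∈-filterᵇ⁺ near z∈ (dec-true (x ~? _) (~-trans (near⁻ y∈) r))) } }
      cls′ {C} (there C∈) = record
        { sublist = x ∷ʳ ⊆-trans (IsClass.sublist (cls C∈)) (filter-⊆ (T? ∘ far) xs)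
        ; related = IsClass.related (cls C∈)
        ; closed = cl }
        where
        cl : ∀ {y z} → y ∈ C → z ∈ x ∷ xs → y ~ z → z ∈ C
        cl y∈ (here refl) r = contradiction (~-sym r) (far⁻ (C⊆far C∈ y∈))
        cl {y} {z} y∈ (there z∈) r with x ~? z in eq
        ... | yes x~z = contradiction (~-trans x~z (~-sym r)) (far⁻ (C⊆far C∈ y∈))
        ... | no _ = IsClass.closed (cls C∈) y∈ (∈-filterᵇ⁺ far z∈ (cong (not ∘ does) eq)) r

  classes : ∀ xs → Classes xs
  classes xs = classes′ (length xs) xs ≤-refl

-- Maps between finite sets are searched as vectors, which can be enumerated and need no
-- extensionality.
vec-∃? : ∀ {m} k {P : Vec (Fin m) k → Set} → (∀ v → Dec (P v)) → Dec (∃ P)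
vec-∃? zero P? = map′ ([] ,_) (λ { ([] , p) → p }) (P? [])
vec-∃? (suc k) P? = map′ (λ { (x , v , p) → x ∷ v , p }) (λ { (x ∷ v , p) → x , v , p })
  (any? (λ x → vec-∃? k (λ v → P? (x ∷ v))))

module _ {n : ℕ} (a c : Fin n) where

  transpose-left : transpose a c a ≡ c
  transpose-left rewrite dec-true (a ≟ a) refl = refl

  transpose-right : transpose a c c ≡ a
  transpose-right with c ≟ a
  ... | yes refl = refl
  ... | no _ rewrite dec-true (c ≟ c) refl = refl

  transpose-other : ∀ {i} → i ≢ a → i ≢ c → transpose a c i ≡ i
  transpose-other {i} i≢a i≢c rewrite dec-false (i ≟ a) i≢a | dec-false (i ≟ c) i≢c = refl

  transpose-involutive : ∀ i → transpose a c (transpose a c i) ≡ i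
  transpose-involutive i with i ≟ a
  ... | yes refl = transpose-right
  ... | no i≢a with i ≟ c
  ...   | yes refl = transpose-left
  ...   | no i≢c = transpose-other i≢a i≢c

-- Matchings and the Tutte–Berge decomposition

module Matchings {n : ℕ} (adj : Fin n → Fin n → Bool) (adj-sym : ∀ x y → adj x y ≡ adj y x)
  (adj-irrefl : ∀ x → adj x x ≡ false) where

  open Cliques adj adj-sym using (Disconnected)

  -- A matching inside U, as the involution exchanging the ends of each edge
  -- (uncovered vertices are its fixed points).
  record Matching (U : Fin n → Bool) : Set where
    field
      mate : Fin n → Fin n
      inv  : ∀ i → mate (mate i) ≡ i
      edge : ∀ {i} → mate i ≢ i → U i ≡ true × adj i (mate i) ≡ true
  open Matching

  vertices : List (Fin n)
  vertices = allFin n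

  lower fixed : (Fin n → Fin n) → Fin n → Bool
  lower f i = toℕ i <ᵇ toℕ (f i)
  fixed f i = does (f i ≟ i)

  size : ∀ {U} → Matching U → ℕ
  size K = count (lower (mate K)) vertices

  -- `f` exchanges the vertices it raises with those it lowers, so in a closed list both kinds are
  -- equally many and one of them counts the pairs.
  length-involution : ∀ f → (∀ i → f (f i) ≡ i) → ∀ {C} → Unique C → (∀ {i} → i ∈ C → f i ∈ C) →
    length C ≡ count (fixed f) C + 2 * count (lower f) C
  length-involution f inv {C} uniq closed = begin
    length C                                                        ≡⟨ trichotomy C ⟩
    count (fixed f) C + count (lower f) C + count (upper) C         ≡⟨ cong (count (fixed f) C + count (lower f) C +_) upper≡lower ⟩
    count (fixed f) C + count (lower f) C + count (lower f) C       ≡⟨ ring₁ (count (fixed f) C) _ ⟩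
    count (fixed f) C + 2 * count (lower f) C                       ∎
    where
    open ≡-Reasoning
    upper : Fin n → Bool
    upper i = toℕ (f i) <ᵇ toℕ i
    upper≡lower : count upper C ≡ count (lower f) C
    upper≡lower = trans (cong length (filterᵇ-cong (λ i → cong (λ z → toℕ (f i) <ᵇ toℕ z) (sym (inv i))) C))
                        (count-involution (lower f) f inv uniq closed)
    ring₁ : ∀ a b → a + b + b ≡ a + 2 * b
    ring₁ = solve-∀
    <ᵇ-true : ∀ {a b} → a < b → (a <ᵇ b) ≡ true
    <ᵇ-true p = Equivalence.to Bool.T-≡ (<⇒<ᵇ p)
    <ᵇ-false : ∀ {a b} → ¬ a < b → (a <ᵇ b) ≡ false
    <ᵇ-false {a} {b} ¬p with a <ᵇ b in eq
    ... | false = refl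
    ... | true = contradiction (<ᵇ⇒< a b (Equivalence.from Bool.T-≡ eq)) ¬p
    trichotomy : ∀ C → length C ≡ count (fixed f) C + count (lower f) C + count upper C
    trichotomy [] = refl
    trichotomy (i ∷ C) with <-cmp (toℕ i) (toℕ (f i))
    ... | tri< a ¬b ¬c rewrite dec-false (f i ≟ i) (¬b ∘ cong toℕ ∘ sym) | <ᵇ-true a | <ᵇ-false ¬c
        = trans (cong suc (trichotomy C)) (cong (_+ count upper C) (sym (+-suc _ _)))
    ... | tri≈ ¬a b ¬c rewrite dec-true (f i ≟ i) (toℕ-injective (sym b)) | <ᵇ-false ¬a | <ᵇ-false ¬c
        = cong suc (trichotomy C)
    ... | tri> ¬a ¬b c rewrite dec-false (f i ≟ i) (¬b ∘ cong toℕ ∘ sym) | <ᵇ-false ¬a | <ᵇ-true c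
        = trans (cong suc (trichotomy C)) (sym (+-suc _ _))

  uncovered : ∀ {U} → Matching U → ℕ
  uncovered K = count (fixed (mate K)) vertices

  uncovered+2size : ∀ {U} (K : Matching U) → uncovered K + 2 * size K ≡ length vertices
  uncovered+2size K = sym (length-involution (mate K) (inv K) (allFin⁺ n) (λ _ → ∈-allFin _))

  -- Sizes are compared through uncovered vertices: `size` depends on the order of the vertices,
  -- which a transposition disturbs, whereas fixed points are merely permuted.
  size-mono : ∀ {U V} (K : Matching U) (L : Matching V) → uncovered L ≤ uncovered K → size K ≤ size L
  size-mono K L le = *-cancelˡ-≤ 2 (+-cancelˡ-≤ (uncovered L) _ _ (begin
    uncovered L + 2 * size K ≤⟨ +-monoˡ-≤ (2 * size K) le ⟩
    uncovered K + 2 * size K ≡⟨ trans (uncovered+2size K) (sym (uncovered+2size L)) ⟩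
    uncovered L + 2 * size L ∎))
    where open ≤-Reasoning

  size-strict : ∀ {U V} (K : Matching U) (L : Matching V) → uncovered L < uncovered K → size K < size L
  size-strict K L lt = *-cancelˡ-< 2 _ _ (+-cancelˡ-< (uncovered L) _ _ (begin-strict
    uncovered L + 2 * size K <⟨ +-monoˡ-< (2 * size K) lt ⟩
    uncovered K + 2 * size K ≡⟨ trans (uncovered+2size K) (sym (uncovered+2size L)) ⟩
    uncovered L + 2 * size L ∎))
    where open ≤-Reasoning

  restrict : ∀ {U V} (K : Matching U) → (∀ {i} → mate K i ≢ i → V i ≡ true) → Matching V
  restrict K h = record { mate = mate K ; inv = inv K ; edge = λ ne → h ne , proj₂ (edge K ne) }

  empty : ∀ {U} → Matching U
  empty = record { mate = id ; inv = λ _ → refl ; edge = λ ne → contradiction refl ne }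

  mate-≢ : ∀ {U} (K : Matching U) {i j} → mate K i ≡ j → i ≢ j → mate K j ≢ j
  mate-≢ K {i} {j} eq i≢j fx = i≢j (trans (sym (inv K i)) (trans (cong (mate K) eq) fx))

  -- The edge ab is replaced by bc, where c is uncovered.
  module Rotate {U} (K : Matching U) {a b c : Fin n} (Ka : mate K a ≡ b) (a≢b : a ≢ b) (Kc : mate K c ≡ c)
    (bc : adj b c ≡ true) (Uc : U c ≡ true) where
    private
      t = transpose a c
      Kb : mate K b ≡ a
      Kb = trans (cong (mate K) (sym Ka)) (inv K a)
      b≢c : b ≢ c
      b≢c refl = a≢b (trans (sym Kb) Kc)
      -- Conjugation by the transposition of `a` and `c` swaps their roles, so the involution law
      -- and the number of fixed points carry over.
      rot : Fin n → Fin n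
      rot = t ∘ mate K ∘ t

    rot-a : rot a ≡ a
    rot-a rewrite transpose-left a c | Kc = transpose-right a c
    rot-b : rot b ≡ c
    rot-b rewrite transpose-other a c (a≢b ∘ sym) b≢c | Kb = transpose-left a c
    rot-c : rot c ≡ b
    rot-c rewrite transpose-right a c | Ka = transpose-other a c (a≢b ∘ sym) b≢c
    rot-other : ∀ {i} → i ≢ a → i ≢ b → i ≢ c → rot i ≡ mate K i
    rot-other {i} i≢a i≢b i≢c rewrite transpose-other a c i≢a i≢c = transpose-other a c
      (λ eq → i≢b (trans (sym (inv K i)) (trans (cong (mate K) eq) Ka)))
      (λ eq → i≢c (trans (sym (inv K i)) (trans (cong (mate K) eq) Kc)))

    rotate : Matching U
    rotate = record { mate = rot ; inv = rinv ; edge = redge }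
      where
      rinv : ∀ i → rot (rot i) ≡ i
      rinv i = trans (cong (t ∘ mate K) (transpose-involutive a c (mate K (t i))))
        (trans (cong t (inv K (t i))) (transpose-involutive a c i))
      redge′ : ∀ {i} → Dec (i ≡ a) → Dec (i ≡ b) → Dec (i ≡ c) → rot i ≢ i → U i ≡ true × adj i (rot i) ≡ true
      redge′ (yes refl) _ _ ne = contradiction rot-a ne
      redge′ {i} (no _) (yes refl) _ ne = proj₁ (edge K (mate-≢ K Ka a≢b)) , trans (cong (adj i) rot-b) bc
      redge′ {i} (no _) (no _) (yes refl) ne = Uc , trans (cong (adj i) rot-c) (trans (adj-sym c b) bc)
      redge′ {i} (no i≢a) (no i≢b) (no i≢c) ne with rot-other i≢a i≢b i≢c
      ... | eq = proj₁ (edge K (subst (_≢ i) eq ne)) , trans (cong (adj i) eq) (proj₂ (edge K (subst (_≢ i) eq ne)))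
      redge : ∀ {i} → rot i ≢ i → U i ≡ true × adj i (rot i) ≡ true
      redge {i} = redge′ (i ≟ a) (i ≟ b) (i ≟ c)

    size-rotate : size K ≤ size rotate
    size-rotate = size-mono K rotate (≤-reflexive (trans (cong length (filterᵇ-cong conj vertices))
        (count-involution (fixed (mate K)) t (transpose-involutive a c) (allFin⁺ n) (λ _ → ∈-allFin _))))
      where
      conj : ∀ i → fixed rot i ≡ fixed (mate K) (t i)
      conj i with mate K (t i) ≟ t i
      ... | yes eq = dec-true (rot i ≟ i) (trans (cong t eq) (transpose-involutive a c i))
      ... | no ne = dec-false (rot i ≟ i) (λ eq → ne (trans (sym (transpose-involutive a c _)) (cong t eq)))

  -- Composing with the transposition of `u` and `v` gives an involution again, since `mate K` fixes
  -- both of them.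
  augment : ∀ {U} (K : Matching U) {u v} → mate K u ≡ u → mate K v ≡ v → adj u v ≡ true →
    U u ≡ true → U v ≡ true → Σ (Matching U) λ L → size K < size L
  augment {U} K {u} {v} Ku Kv uv Uu Uv = L , size-strict K L
      (count-strict vertices mono (∈-allFin u) (dec-false (aug u ≟ u) (λ eq → u≢v (trans (sym eq) aug-u))) (dec-true (mate K u ≟ u) Ku))
    where
    t = transpose u v
    aug : Fin n → Fin n
    aug = t ∘ mate K
    u≢v : u ≢ v
    u≢v refl = true≢false (trans (sym uv) (adj-irrefl u))
    aug-u : aug u ≡ v
    aug-u rewrite Ku = transpose-left u v
    aug-v : aug v ≡ u
    aug-v rewrite Kv = transpose-right u v
    K-≢ : ∀ {i x} → mate K x ≡ x → i ≢ x → mate K i ≢ x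
    K-≢ {i} Kx i≢x eq = i≢x (trans (sym (inv K i)) (trans (cong (mate K) eq) Kx))
    aug-other : ∀ {i} → i ≢ u → i ≢ v → aug i ≡ mate K i
    aug-other i≢u i≢v = transpose-other u v (K-≢ Ku i≢u) (K-≢ Kv i≢v)
    L : Matching U
    L = record { mate = aug ; inv = linv ; edge = ledge }
      where
      linv′ : ∀ {i} → Dec (i ≡ u) → Dec (i ≡ v) → aug (aug i) ≡ i
      linv′ (yes refl) _ = trans (cong aug aug-u) aug-v
      linv′ (no _) (yes refl) = trans (cong aug aug-v) aug-u
      linv′ {i} (no i≢u) (no i≢v) = trans (cong aug (aug-other i≢u i≢v)) (trans (aug-other (K-≢ Ku i≢u) (K-≢ Kv i≢v)) (inv K i))
      linv : ∀ i → aug (aug i) ≡ i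
      linv i = linv′ (i ≟ u) (i ≟ v)
      ledge′ : ∀ {i} → Dec (i ≡ u) → Dec (i ≡ v) → aug i ≢ i → U i ≡ true × adj i (aug i) ≡ true
      ledge′ {i} (yes refl) _ ne = Uu , trans (cong (adj i) aug-u) uv
      ledge′ {i} (no _) (yes refl) ne = Uv , trans (cong (adj i) aug-v) (trans (adj-sym v u) uv)
      ledge′ {i} (no i≢u) (no i≢v) ne with aug-other i≢u i≢v
      ... | eq = proj₁ (edge K (subst (_≢ i) eq ne)) , trans (cong (adj i) eq) (proj₂ (edge K (subst (_≢ i) eq ne)))
      ledge : ∀ {i} → aug i ≢ i → U i ≡ true × adj i (aug i) ≡ true
      ledge {i} = ledge′ (i ≟ u) (i ≟ v)
    mono : ∀ {i} → i ∈ vertices → fixed aug i ≡ true → fixed (mate K) i ≡ true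
    mono {i} _ fx with aug i ≟ i
    ... | yes eq = dec-true (mate K i ≟ i) (trans (sym (aug-other i≢u i≢v)) eq)
      where
      i≢u : i ≢ u
      i≢u refl = u≢v (trans (sym eq) aug-u)
      i≢v : i ≢ v
      i≢v refl = u≢v (trans (sym aug-v) eq)

  Has : (Fin n → Bool) → ℕ → Set
  Has U ν = Σ (Matching U) λ K → ν ≤ size K

  -- Deciding this by exhaustive search makes the case distinctions on maximum matchings and on
  -- vertices that all of them cover constructive.
  has? : ∀ U ν → Dec (Has U ν)
  has? U ν = map′ to from (vec-∃? n valid?)
    where
    Valid : Vec (Fin n) n → Set
    Valid v = (∀ i → lookup v (lookup v i) ≡ i) ×
      (∀ i → lookup v i ≢ i → U i ≡ true × adj i (lookup v i) ≡ true) × ν ≤ count (lower (lookup v)) vertices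
    valid? : ∀ v → Dec (Valid v)
    valid? v = all? (λ i → lookup v (lookup v i) ≟ i) ×-dec
      all? (λ i → ¬? (lookup v i ≟ i) →-dec ((U i Bool.≟ true) ×-dec (adj i (lookup v i) Bool.≟ true))) ×-dec
      (ν ≤? _)
    to : ∃ Valid → Has U ν
    to (v , i , e , s) = record { mate = lookup v ; inv = i ; edge = λ {j} → e j } , s
    from : Has U ν → ∃ Valid
    from (K , s) = tabulate (mate K) ,
      (λ i → trans (lt (lookup (tabulate (mate K)) i)) (trans (cong (mate K) (lt i)) (inv K i))) ,
      (λ i ne → let (a , b) = edge K (subst (_≢ i) (lt i) ne) in a , trans (cong (adj i) (lt i)) b) ,
      ≤-trans s (≤-reflexive (cong length (filterᵇ-cong (λ i → cong (λ z → toℕ i <ᵇ toℕ z) (sym (lt i))) vertices)))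
      where
      lt : ∀ i → lookup (tabulate (mate K)) i ≡ mate K i
      lt = lookup∘tabulate (mate K)

  -- The alternating path of K and L that starts at v is followed by moving L
  -- towards K; K is then rotated along it, and x is the other end of the path.
  exchange : ∀ {U ν} → ¬ Has U (suc ν) → ∀ m (K L : Matching U) v →
    count (λ i → not (does (mate K i ≟ mate L i))) vertices ≤ m → ν ≤ size K → ν ≤ size L →
    mate L v ≡ v → mate K v ≢ v →
    ∃₂ λ (M : Matching U) x → ν ≤ size M × mate M v ≡ v ×
      (∀ i → mate K i ≡ i → i ≢ x → mate M i ≡ i) × (∀ i → mate K i ≡ mate L i → mate M i ≡ mate K i)
  exchange {U} {ν} max m K L v diff νK νL Lv Kv = go m diff
    where
    v₁ = mate K v
    v₂ = mate L v₁
    v≢v₁ : v ≢ v₁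
    v≢v₁ = Kv ∘ sym
    Kv₁ : mate K v₁ ≡ v
    Kv₁ = inv K v
    -- Otherwise the edge from `v` to `v₁` could be added to `L`, beyond the maximum size.
    Lv₁ : mate L v₁ ≢ v₁
    Lv₁ eq with augment L Lv eq (proj₂ (edge K Kv)) (proj₁ (edge K Kv)) (proj₁ (edge K (mate-≢ K refl v≢v₁)))
    ... | L′ , lt = max (L′ , ≤-trans (s≤s νL) lt)
    Lv₂ : mate L v₂ ≡ v₁
    Lv₂ = inv L v₁
    v₂≢v₁ : v₂ ≢ v₁
    v₂≢v₁ = Lv₁
    v≢v₂ : v ≢ v₂
    v≢v₂ eq = v≢v₁ (trans (sym Lv) (trans (cong (mate L) eq) Lv₂))
    Uv = proj₁ (edge K Kv)
    Uv₂ = proj₁ (edge L (mate-≢ L refl (Lv₁ ∘ sym)))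
    v₁v : adj v₁ v ≡ true
    v₁v = trans (adj-sym v₁ v) (proj₂ (edge K Kv))
    v₁v₂ : adj v₁ v₂ ≡ true
    v₁v₂ = proj₂ (edge L Lv₁)
    agree-≢ : ∀ {i} → mate K i ≡ mate L i → i ≢ v × i ≢ v₁ × i ≢ v₂
    agree-≢ eq = (λ { refl → Kv (trans eq Lv) }) , (λ { refl → v≢v₂ (trans (sym Kv₁) eq) }) ,
      (λ { refl → v≢v₂ (trans (trans (sym Kv₁) (cong (mate K) (sym (trans eq Lv₂)))) (inv K _)) })
    -- The edge `v₂ v₁` of `L` becomes `v₁ v`. The new matching agrees with `K` at `v` and misses
    -- `v₂`, so the rest of the path starts at `v₂` and there are fewer disagreements.
    module L′ = Rotate L Lv₂ v₂≢v₁ Lv v₁v Uv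
    go : ∀ m → count (λ i → not (does (mate K i ≟ mate L i))) vertices ≤ m → _
    go m diff with mate K v₂ ≟ v₂
    -- The path ends at `v₂`: in `K` the edge `v v₁` is replaced by `v₁ v₂`, which uncovers `v` at
    -- the expense of `v₂` alone.
    ... | yes Kv₂ = M.rotate , v₂ , ≤-trans νK M.size-rotate , M.rot-a ,
          (λ i Ki i≢v₂ → trans (M.rot-other (λ { refl → Kv Ki }) (λ { refl → v≢v₁ (trans (sym Kv₁) Ki) }) i≢v₂) Ki) ,
          (λ i eq → let (a , b , c) = agree-≢ eq in M.rot-other a b c)
      where module M = Rotate K {a = v} refl v≢v₁ Kv₂ v₁v₂ Uv₂
    go zero diff | no Kv₂ = contradiction (≤-trans (count-strict {p = const false} vertices (λ _ ()) (∈-allFin v) refl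
        (cong not (dec-false (mate K v ≟ mate L v) (λ eq → Kv (trans eq Lv))))) diff) (λ lt → n≮0 lt)
    go (suc m) diff | no Kv₂ with exchange max m K L′.rotate v₂ closer νK (≤-trans νL L′.size-rotate) L′.rot-a Kv₂
      where
      closer : count (λ i → not (does (mate K i ≟ mate L′.rotate i))) vertices ≤ m
      closer = s≤s⁻¹ (≤-trans (count-strict vertices sub (∈-allFin v)
          (cong not (dec-true (mate K v ≟ _) (sym L′.rot-c))) (cong not (dec-false (mate K v ≟ mate L v) (λ eq → Kv (trans eq Lv))))) diff)
        where
        sub : ∀ {i} → i ∈ vertices → not (does (mate K i ≟ mate L′.rotate i)) ≡ true → not (does (mate K i ≟ mate L i)) ≡ true
        sub {i} _ h with mate K i ≟ mate L i
        ... | no _ = refl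
        ... | yes eq with agree-≢ eq
        ...   | a , b , c = contradiction (trans (sym h) (cong not (dec-true (mate K i ≟ _) (trans eq (sym (L′.rot-other c b a)))))) true≢false
    ... | M₀ , x , νM , M₀v₂ , keep , agree = M.rotate , x , ≤-trans νM M.size-rotate , M.rot-a ,
          (λ i Ki i≢x → trans (M.rot-other (λ { refl → Kv Ki }) (λ { refl → v≢v₁ (trans (sym Kv₁) Ki) }) (λ { refl → Kv₂ Ki })) (keep i Ki i≢x)) ,
          (λ i eq → let (a , b , c) = agree-≢ eq in trans (M.rot-other a b c) (agree i (trans eq (sym (L′.rot-other c b a)))))
      where
      -- The last conclusion of `exchange` is carried for this point: the recursive call must keep
      -- the edge `v v₁`, on which `K` and the rotated `L` agree.
      M₀v : mate M₀ v ≡ v₁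
      M₀v = agree v (sym L′.rot-c)
      module M = Rotate M₀ {a = v} M₀v v≢v₁ M₀v₂ v₁v₂ Uv₂

module TutteBerge {n : ℕ} (adj : Fin n → Fin n → Bool) (adj-sym : ∀ x y → adj x y ≡ adj y x)
  (adj-irrefl : ∀ x → adj x x ≡ false) where

  open Cliques adj adj-sym using (Disconnected)
  open Matchings adj adj-sym adj-irrefl
  open Matching

  infixl 6 _∖_
  _∖_ : (Fin n → Bool) → Fin n → Fin n → Bool
  (U ∖ v) i = U i ∧ not (does (i ≟ v))

  ∖⁺ : ∀ {U v i} → U i ≡ true → i ≢ v → (U ∖ v) i ≡ true
  ∖⁺ {U} {v} {i} Ui i≢v rewrite Ui | dec-false (i ≟ v) i≢v = refl

  ∖⁻ : ∀ {U v i} → (U ∖ v) i ≡ true → U i ≡ true × i ≢ v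
  ∖⁻ {U} {v} {i} h with U i | i ≟ v
  ... | true | no i≢v = refl , i≢v

  avoids : ∀ {U v} (K : Matching (U ∖ v)) → mate K v ≡ v
  avoids {U} {v} K with mate K v ≟ v
  ... | yes eq = eq
  ... | no ne = contradiction refl (proj₂ (∖⁻ {U} (proj₁ (edge K ne))))

  include : ∀ {U v} → Matching (U ∖ v) → Matching U
  include {U} K = restrict K (λ ne → proj₁ (∖⁻ {U} (proj₁ (edge K ne))))

  exclude : ∀ {U} (K : Matching U) v → mate K v ≡ v → Matching (U ∖ v)
  exclude {U} K v Kv = restrict K (λ ne → ∖⁺ {U} (proj₁ (edge K ne)) (λ { refl → ne Kv }))

  Decomposition : (Fin n → Bool) → ℕ → Set
  Decomposition U s = ∃₂ λ B Cs → concat Cs ++ B ↭ filterᵇ U vertices × AllPairs Disconnected Cs ×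
    length B + sum (map (λ C → ⌊ length C /2⌋) Cs) ≤ s

  module Gallai {U ν} (has : Has U ν) (max : ¬ Has U (suc ν)) (all : ∀ v → Has (U ∖ v) ν) where

    -- No maximum matching misses both u and v.
    _~_ : Fin n → Fin n → Set
    u ~ v = u ≡ v ⊎ ¬ Has (U ∖ u ∖ v) ν

    _~?_ : ∀ u v → Dec (u ~ v)
    u ~? v = (u ≟ v) ⊎-dec ¬? (has? (U ∖ u ∖ v) ν)

    ~-intro : ∀ {u v} → ((K : Matching U) → ν ≤ size K → mate K u ≡ u → mate K v ≡ v → u ≡ v) → u ~ v
    ~-intro {u} {v} h with u ≟ v
    ... | yes eq = inj₁ eq
    ... | no ne = inj₂ λ (K , νK) → ne (h (include (include K)) νK (avoids (include K)) (avoids K))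

    ~-elim : ∀ {u v} → u ~ v → (K : Matching U) → ν ≤ size K → mate K u ≡ u → mate K v ≡ v → u ≡ v
    ~-elim (inj₁ eq) K νK Ku Kv = eq
    ~-elim (inj₂ ¬has) K νK Ku Kv = contradiction (exclude (exclude K _ Ku) _ Kv , νK) ¬has

    ~-sym : ∀ {u v} → u ~ v → v ~ u
    ~-sym r = ~-intro (λ K νK Kv Ku → sym (~-elim r K νK Ku Kv))

    -- Suppose a maximum matching `K` misses distinct `u` and `w` but covers `v`. Exchanging it
    -- against one that misses `v` keeps all but one of its uncovered vertices, so `u` or `w` is
    -- missed together with `v`, contrary to one of the two relations.
    ~-trans : ∀ {u v w} → u ~ v → v ~ w → u ~ w
    ~-trans {u} {v} {w} r r′ = ~-intro step
      where
      step : (K : Matching U) → ν ≤ size K → mate K u ≡ u → mate K w ≡ w → u ≡ w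
      step K νK Ku Kw with mate K v ≟ v
      ... | yes Kv = trans (~-elim r K νK Ku Kv) (~-elim r′ K νK Kv Kw)
      ... | no Kv with all v
      ...   | L , νL with exchange max _ K (include L) v ≤-refl νK νL (avoids L) Kv
      ...     | M , x , νM , Mv , keep , _ with u ≟ x
      ...       | no u≢x = contradiction (subst (λ z → mate K z ≡ z) (~-elim r M νM (keep u Ku u≢x) Mv) Ku) Kv
      ...       | yes refl with w ≟ u
      ...         | yes eq = sym eq
      ...         | no w≢u = contradiction (subst (λ z → mate K z ≡ z) (sym (~-elim r′ M νM Mv (keep w Kw w≢u))) Kw) Kv

    adj⇒~ : ∀ {u v} → U u ≡ true → U v ≡ true → adj u v ≡ true → u ~ v
    adj⇒~ Uu Uv uv = ~-intro λ K νK Ku Kv →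
      let (L , lt) = augment K Ku Kv uv Uu Uv in contradiction (L , ≤-trans (s≤s νK) lt) max

    -- Adjacent vertices are related, since a maximum matching missing both could be augmented. So
    -- distinct classes are non-adjacent, and a maximum matching maps each class to itself. It
    -- misses at most one vertex per class and thus has ⌊∣C∣/2⌋ edges in each class `C`.
    decomposition : Decomposition U ν
    decomposition with classes _~_ _~?_ (inj₁ refl) ~-sym ~-trans (filterᵇ U vertices)
    ... | Cs , perm , sep , cls = [] , Cs , ↭-trans (Perm.++-identityʳ (concat Cs)) perm , disc sep cls , bound
      where
      open ≤-Reasoning
      V = filterᵇ U vertices
      K = proj₁ has
      IsCl = IsClass _~_ _~?_ (λ {x} → inj₁ refl) ~-sym ~-trans
      inU : ∀ {C i} → IsCl V C → i ∈ C → U i ≡ true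
      inU c i∈ = proj₂ (∈-filterᵇ⁻ U {xs = vertices} (⊆-lookup (IsClass.sublist c) i∈))
      disc : ∀ {Cs} → AllPairs (λ C D → ∀ {x y} → x ∈ C → y ∈ D → ¬ x ~ y) Cs →
        (∀ {C} → C ∈ Cs → IsCl V C) → AllPairs Disconnected Cs
      disc [] cls = []
      disc (s ∷ sep) cls = All.tabulate (λ D∈ {x} {y} x∈ y∈ → Bool.¬-not λ xy →
          All.lookup s D∈ x∈ y∈ (adj⇒~ (inU (cls (here refl)) x∈) (inU (cls (there D∈)) y∈) xy)) ∷ disc sep (cls ∘ there)
      half≤ : ∀ {C} → IsCl V C → ⌊ length C /2⌋ ≤ count (lower (mate K)) C
      half≤ {C} c = begin
        ⌊ length C /2⌋                              ≡⟨ cong ⌊_/2⌋ (length-involution (mate K) (inv K) uniq closed) ⟩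
        ⌊ count (fixed (mate K)) C + 2 * e /2⌋      ≤⟨ ⌊n/2⌋-mono (+-monoˡ-≤ (2 * e) (count-≤1 (fixed (mate K)) uniq one)) ⟩
        ⌊ 1 + 2 * e /2⌋                             ≡⟨ half-odd e ⟩
        e                                           ∎
        where
        e = count (lower (mate K)) C
        half-odd : ∀ e → ⌊ 1 + 2 * e /2⌋ ≡ e
        half-odd zero = refl
        half-odd (suc e) rewrite +-suc e (e + 0) = cong suc (half-odd e)
        uniq : Unique C
        uniq = Unique-resp-⊆ (IsClass.sublist c) (Unique-filter⁺ (T? ∘ U) (allFin⁺ n))
        fixed⁻ : ∀ {i} → fixed (mate K) i ≡ true → mate K i ≡ i
        fixed⁻ {i} h with mate K i ≟ i
        ... | yes eq = eq
        one : ∀ {x y} → x ∈ C → y ∈ C → fixed (mate K) x ≡ true → fixed (mate K) y ≡ true → x ≡ y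
        one x∈ y∈ fx fy = ~-elim (IsClass.related c x∈ y∈) K (proj₂ has) (fixed⁻ fx) (fixed⁻ fy)
        closed : ∀ {i} → i ∈ C → mate K i ∈ C
        closed {i} i∈ with mate K i ≟ i
        ... | yes eq = subst (_∈ C) (sym eq) i∈
        ... | no ne = IsClass.closed c i∈ (∈-filterᵇ⁺ U (∈-allFin _) Uj) (adj⇒~ (inU c i∈) Uj (proj₂ (edge K ne)))
          where
          Uj : U (mate K i) ≡ true
          Uj = proj₁ (edge K (mate-≢ K refl (ne ∘ sym)))
      bound : sum (map (λ C → ⌊ length C /2⌋) Cs) ≤ ν
      bound = begin
        sum (map (λ C → ⌊ length C /2⌋) Cs)         ≤⟨ sum-map-mono Cs (half≤ ∘ cls) ⟩
        sum (map (count (lower (mate K))) Cs)       ≡⟨ count-concat _ Cs ⟨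
        count (lower (mate K)) (concat Cs)          ≡⟨ count-↭ _ perm ⟩
        count (lower (mate K)) V                    ≤⟨ length-mono-≤
                                                         (filterᵇ-⊆ (filter-⊆ (T? ∘ U) vertices)) ⟩
        size K                                      ≤⟨ ≮⇒≥ (λ lt → max (K , lt)) ⟩
        ν                                           ∎
        where
        filterᵇ-⊆ : ∀ {xs ys} → xs ⊆ ys → filterᵇ (lower (mate K)) xs ⊆ filterᵇ (lower (mate K)) ys
        filterᵇ-⊆ = filter⁺ _ _ (λ { refl z → z })

  -- `s` only bounds the matching number and is lowered until it is attained. Deleting a vertex that
  -- every maximum matching covers lowers the matching number, which pays for its place in `B`.
  tutte-berge : ∀ s U → ¬ Has U (suc s) → Decomposition U s
  tutte-berge s U max with has? U s
  tutte-berge zero U max | no ¬has = contradiction (empty , z≤n) ¬has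
  tutte-berge (suc s) U max | no ¬has with tutte-berge s U ¬has
  ... | B , Cs , perm , disc , le = B , Cs , perm , disc , m≤n⇒m≤1+n le
  tutte-berge s U max | yes has with any? (λ v → ¬? (has? (U ∖ v) s))
  ... | no all = Gallai.decomposition has max (λ v → decidable-stable (has? (U ∖ v) s) (λ ¬h → all (v , ¬h)))
  tutte-berge zero U max | yes has | yes (v , ¬h) = contradiction (empty , z≤n) ¬h
  tutte-berge (suc s) U max | yes has@(K , νK) | yes (v , ¬h) with tutte-berge s (U ∖ v) ¬h
  ... | B , Cs , perm , disc , le = v ∷ B , Cs , perm′ , disc , s≤s le
    where
    Uv : U v ≡ true
    Uv with mate K v ≟ v
    ... | yes Kv = contradiction (exclude K v Kv , νK) ¬h
    ... | no ne = proj₁ (edge K ne)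
    perm′ : concat Cs ++ v ∷ B ↭ filterᵇ U vertices
    perm′ = ↭-trans (shift v (concat Cs) B) (↭-trans (prep v perm) (unique-↭
      (All.tabulate (λ { x∈ refl → proj₂ (∖⁻ {U} (proj₂ (∈-filterᵇ⁻ (U ∖ v) {xs = vertices} x∈))) refl })
        ∷ Unique-filter⁺ (T? ∘ (U ∖ v)) (allFin⁺ n))
      (Unique-filter⁺ (T? ∘ U) (allFin⁺ n))
      (λ { (here refl) → ∈-filterᵇ⁺ U (∈-allFin _) Uv
         ; (there x∈) → ∈-filterᵇ⁺ U (∈-allFin _) (proj₁ (∖⁻ {U} (proj₂ (∈-filterᵇ⁻ (U ∖ v) {xs = vertices} x∈)))) })
      from))
      where
      from : ∀ {x} → x ∈ filterᵇ U vertices → x ∈ v ∷ filterᵇ (U ∖ v) vertices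
      from {x} x∈ with x ≟ v
      ... | yes refl = here refl
      ... | no x≢v = there (∈-filterᵇ⁺ (U ∖ v) (∈-allFin _) (∖⁺ {U} (proj₂ (∈-filterᵇ⁻ U {xs = vertices} x∈)) x≢v))

-- Comparison with the extreme decompositions

parity : ℕ → ℕ
parity zero = 0
parity (suc zero) = 1
parity (suc (suc n)) = parity n

2*half+parity : ∀ n → 2 * ⌊ n /2⌋ + parity n ≡ n
2*half+parity zero = refl
2*half+parity (suc zero) = refl
2*half+parity (suc (suc n)) = trans (cong (_+ parity n) (*-suc 2 ⌊ n /2⌋)) (cong (2 +_) (2*half+parity n))

parity-≤1 : ∀ n → parity n ≤ 1
parity-≤1 zero = z≤n
parity-≤1 (suc zero) = s≤s z≤n
parity-≤1 (suc (suc n)) = parity-≤1 n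

∈⇒≤sum : ∀ (f : A → ℕ) {x xs} → x ∈ xs → f x ≤ sum (map f xs)
∈⇒≤sum f (here refl) = m≤m+n _ _
∈⇒≤sum f {xs = y ∷ _} (there x∈) = ≤-trans (∈⇒≤sum f x∈) (m≤n+m _ (f y))

-- The function sees the component as well as the vertex, because δ compares degrees that are taken
-- in different lists `C ++ B`.
argmax-concat : ∀ (f : List A → A → ℕ) Cs → concat Cs ≢ [] →
  ∃₂ λ D v → D ∈ Cs × (∀ {C x} → C ∈ Cs → x ∈ C → f C x ≤ f D v)
argmax-concat f [] ne = contradiction refl ne
argmax-concat f ([] ∷ Cs) ne with argmax-concat f Cs ne
... | D , v , D∈ , max = D , v , there D∈ , λ { (here refl) () ; (there C∈) x∈ → max C∈ x∈ }
argmax-concat f (C@(_ ∷ _) ∷ Cs) ne with argmax (f C) C (λ ()) | concat Cs in eq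
... | v , _ , maxC | [] = C , v , here refl , λ where
  (here refl) x∈ → maxC x∈
  (there D∈) x∈ → contradiction (subst (_ ∈_) eq (∈-concat⁺′ x∈ D∈)) ∉[]
... | v , _ , maxC | _ ∷ _ with argmax-concat f Cs (λ e → contradiction (trans (sym e) eq) (λ ()))
...   | D , u , D∈ , max with ≤-total (f C v) (f D u)
...     | inj₁ le = D , u , there D∈ , λ where
  (here refl) x∈ → ≤-trans (maxC x∈) le
  (there C∈) x∈ → max C∈ x∈
...     | inj₂ ge = C , v , here refl , λ where
  (here refl) x∈ → maxC x∈
  (there C∈) x∈ → ≤-trans (max C∈ x∈) ge

-- The failed threshold inequality and the double counting of the `g` cliques combine once `b` is
-- cancelled.
cancel-≤ : ∀ b t {g δ h} → 1 ≤ b → b * δ ≤ (b + t) * g → 2 * g ≤ b * h → 2 * δ ≤ (b + t) * h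
cancel-≤ b@(suc _) t {g} {δ} {h} _ p q = *-cancelˡ-≤ b (begin
  b * (2 * δ)          ≡⟨ ring₁ b δ ⟩
  2 * (b * δ)          ≤⟨ *-monoʳ-≤ 2 p ⟩
  2 * ((b + t) * g)    ≡⟨ ring₁ (b + t) g ⟨
  (b + t) * (2 * g)    ≤⟨ *-monoʳ-≤ (b + t) q ⟩
  (b + t) * (b * h)    ≡⟨ ring₂ (b + t) b h ⟩
  b * ((b + t) * h)    ∎)
  where
  open ≤-Reasoning
  ring₁ : ∀ b x → b * (2 * x) ≡ 2 * (b * x)
  ring₁ = solve-∀
  ring₂ : ∀ x b h → x * (b * h) ≡ b * (x * h)
  ring₂ = solve-∀

module Extremes {A : Set} (adj : A → A → Bool) (adj-sym : ∀ x y → adj x y ≡ adj y x)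
  (adj-irrefl : ∀ x → adj x x ≡ false) where
  open Cliques adj adj-sym

  -- A component C contributes at most its share β: each matched pair is worth 2δ
  -- and the vertex left over in an odd component is worth g.
  β : ℕ → ℕ → List A → ℕ
  β g δ C = 2 * ⌊ length C /2⌋ * δ + parity (length C) * g

  -- With c = ∣C∣, doubling reduces the claim to c g + c δ ≤ 2 β. For even c the slack is c (δ - g),
  -- for odd c it is (c - 2)(δ - g). The latter is negative for c = 1, so a single vertex is treated
  -- directly: its only cliques are those with `B`.
  component-≤ : ∀ w {g δ} C B → g ≤ δ → (∀ {v} → v ∈ C → deg w B v ≤ g) → (∀ {v} → v ∈ C → deg w (C ++ B) v ≤ δ) →
    Φ w (C ++ B) ≤ Φ w B + β g δ C
  component-≤ w [] B g≤δ hB hC = m≤m+n _ _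
  component-≤ w {g} (v ∷ []) B g≤δ hB hC rewrite Φ-∷ w v B | +-identityʳ g = +-monoʳ-≤ (Φ w B) (hB (here refl))
  component-≤ w {g} {δ} C@(_ ∷ _ ∷ C′) B g≤δ hB hC = *-cancelˡ-≤ 2 (begin
    2 * Φ w (C ++ B)                                ≤⟨ 2Φ-++-≤ adj-irrefl w C B ⟩
    2 * Φ w B + (sum (map (deg w B) C) + sum (map (deg w (C ++ B)) C))
                                                    ≤⟨ +-monoʳ-≤ (2 * Φ w B) (+-mono-≤ (sum-map-≤* C hB) (sum-map-≤* C hC)) ⟩
    2 * Φ w B + (c * g + c * δ)                     ≤⟨ +-monoʳ-≤ (2 * Φ w B) share ⟩
    2 * Φ w B + 2 * β g δ C                         ≡⟨ *-distribˡ-+ 2 (Φ w B) (β g δ C) ⟨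
    2 * (Φ w B + β g δ C)                           ∎)
    where
    open ≤-Reasoning
    c = length C
    a = ⌊ length C′ /2⌋
    arith : ∀ ε x g → ε ≤ 1 → (2 * suc a + ε) * g + (2 * suc a + ε) * (g + x) ≤ 2 * (2 * suc a * (g + x) + ε * g)
    arith 0 x g _ = ≤-trans (m≤m+n _ (2 * suc a * x)) (≤-reflexive (ring₀ a x g))
      where
      ring₀ : ∀ a x g → (2 * (1 + a) + 0) * g + (2 * (1 + a) + 0) * (g + x) + 2 * (1 + a) * x ≡ 2 * (2 * (1 + a) * (g + x) + 0 * g)
      ring₀ = solve-∀
    arith 1 x g _ = ≤-trans (m≤m+n _ ((2 * a + 1) * x)) (≤-reflexive (ring₁ a x g))
      where
      ring₁ : ∀ a x g → (2 * (1 + a) + 1) * g + (2 * (1 + a) + 1) * (g + x) + (2 * a + 1) * x ≡ 2 * (2 * (1 + a) * (g + x) + 1 * g)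
      ring₁ = solve-∀
    arith (suc (suc ε)) x g (s≤s ())
    share : c * g + c * δ ≤ 2 * β g δ C
    share = subst₂ (λ k d → k * g + k * d ≤ 2 * (2 * suc a * d + parity c * g)) (2*half+parity c) (m+[n∸m]≡n g≤δ)
      (arith (parity c) (δ ∸ g) g (parity-≤1 c))

  sum-β : ∀ g δ Cs → sum (map (β g δ) Cs) ≡
    2 * sum (map (λ C → ⌊ length C /2⌋) Cs) * δ + sum (map (parity ∘ length) Cs) * g
  sum-β g δ [] = refl
  sum-β g δ (C ∷ Cs) rewrite sum-β g δ Cs = ring₁ ⌊ length C /2⌋ (parity (length C)) δ g _ _
    where
    ring₁ : ∀ a e δ g x y → 2 * a * δ + e * g + (2 * x * δ + y * g) ≡ 2 * (a + x) * δ + (e + y) * g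
    ring₁ = solve-∀

  sum-lengths : ∀ (Cs : List (List A)) →
    length (concat Cs) ≡ 2 * sum (map (λ C → ⌊ length C /2⌋) Cs) + sum (map (parity ∘ length) Cs)
  sum-lengths [] = refl
  sum-lengths (C ∷ Cs) rewrite length-++ C {concat Cs} | sum-lengths Cs =
    trans (cong (_+ _) (sym (2*half+parity (length C)))) (ring₁ ⌊ length C /2⌋ (parity (length C)) _ _)
    where
    ring₁ : ∀ a e x y → 2 * a + e + (2 * x + y) ≡ 2 * (a + x) + (e + y)
    ring₁ = solve-∀

  -- Double counting: cliques with fewer than two vertices have weight zero, so each one that
  -- matters is seen from at least two of its vertices.
  2Φ≤ : ∀ w X {h} → w 0 ≡ 0 → w 1 ≡ 0 → (∀ {v} → v ∈ X → deg w X v ≤ h) → 2 * Φ w X ≤ length X * h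
  2Φ≤ w X {h} w0 w1 hX = begin
    2 * Φ w X                                                          ≡⟨ cong (λ z → 2 * Φ w z) (++-identityʳ X) ⟨
    2 * Φ w (X ++ [])                                                  ≤⟨ 2Φ-++-≤ adj-irrefl w X [] ⟩
    2 * w 0 + (sum (map (deg w []) X) + sum (map (deg w (X ++ [])) X)) ≡⟨ cong₂ (λ a ys → 2 * a + (sum (map (deg w []) X) + sum (map (deg w ys) X))) w0 (++-identityʳ X) ⟩
    sum (map (deg w []) X) + sum (map (deg w X) X)                     ≤⟨ +-mono-≤ (sum-map-≤* X (λ _ → ≤-reflexive w1)) (sum-map-≤* X hX) ⟩
    length X * 0 + length X * h                                        ≡⟨ cong (_+ length X * h) (*-zeroʳ (length X)) ⟩
    length X * h                                                       ∎
    where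
    open ≤-Reasoning

  -- The list `xs` uses the same adjacency, so clique-freeness will be available for it and only its
  -- length has to be recorded. In `Cover` the number `s + 1 + t` is n - s.
  Big : (ℕ → ℕ) → ℕ → List A → Set
  Big w s zs = ∃ λ xs → length xs ≡ 2 * s + 1 × Φ w zs ≤ Φ w xs

  Cover : (ℕ → ℕ) → ℕ → ℕ → List A → Set
  Cover w s t zs = ∃₂ λ d xs → length xs ≡ 2 * s + 1 + t × replicate (s + 1 + t) d ⊆ xs × Φ w zs ≤ Φ w xs

  module _ (w : ℕ → ℕ) (w1 : w 1 ≡ 0) (w2 : w 2 ≡ 0) where

    module _ (s t : ℕ) (B : List A) (Cs : List (List A)) (disc : AllPairs Disconnected Cs)
      (le : length B + sum (map (λ C → ⌊ length C /2⌋) Cs) ≤ s) (len : length (concat Cs ++ B) ≡ 2 * s + 1 + t)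
      (d v : A) (D : List A) (D∈ : D ∈ Cs) (hB : ∀ {C x} → C ∈ Cs → x ∈ C → deg w B x ≤ deg w B d)
      (hC : ∀ {C x} → C ∈ Cs → x ∈ C → deg w (C ++ B) x ≤ deg w (D ++ B) v) (g≤δ : deg w B d ≤ deg w (D ++ B) v) where
      private
        open ≤-Reasoning
        b = length B
        a₊ = sum (map (λ C → ⌊ length C /2⌋) Cs)
        P = sum (map (parity ∘ length) Cs)
        u = s ∸ (b + a₊)
        s≡ : s ≡ b + a₊ + u
        s≡ = sym (m+[n∸m]≡n le)
        -- The number of odd components, from 2 a₊ + P + b = 2 s + 1 + t and s = b + a₊ + u.
        P≡ : P ≡ b + t + 1 + 2 * u
        P≡ = +-cancelˡ-≡ (2 * a₊ + b) _ _ (trans (ring₁ a₊ b P) (trans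
          (trans (cong (_+ b) (sym (sum-lengths Cs))) (sym (length-++ (concat Cs))))
          (trans len (trans (cong (λ z → 2 * z + 1 + t) s≡) (ring₂ a₊ b u t)))))
          where
          ring₁ : ∀ a b p → 2 * a + b + p ≡ 2 * a + p + b
          ring₁ = solve-∀
          ring₂ : ∀ a b u t → 2 * (b + a + u) + 1 + t ≡ 2 * a + b + (b + t + 1 + 2 * u)
          ring₂ = solve-∀
        V = concat Cs
        g = deg w B d
        δ = deg w (D ++ B) v
        comp : ∀ {C} → C ∈ Cs → Φ w (C ++ B) ≤ Φ w B + β g δ C
        comp {C} C∈ = component-≤ w C B g≤δ (hB C∈) (hC C∈)
        Σβ≡ : sum (map (β g δ) Cs) ≡ 2 * a₊ * δ + (b + t + 1 + 2 * u) * g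
        Σβ≡ = trans (sum-β g δ Cs) (cong (λ z → 2 * a₊ * δ + z * g) P≡)

        -- Copies of `v`, each worth δ, replace the shares of all components except `D`. The 2 a′
        -- copies match the pairs term by term, b copies pay for b + t odd components by assumption,
        -- and the remaining ε′ + 2 u shares are covered by g ≤ δ.
        big : (b + t) * g ≤ b * δ → Big w s (V ++ B)
        big small = replicate j v ++ (D ++ B) , len≡ , +-cancelʳ-≤ (2 * a * δ + ε * g) _ _ (begin
          Φ w (V ++ B) + β g δ D                                          ≤⟨ Φ-components-∈ w (β g δ) B Cs disc comp D∈ ⟩
          Φ w (D ++ B) + sum (map (β g δ) Cs)                             ≡⟨ cong (Φ w (D ++ B) +_) Σβ≡ ⟩
          Φ w (D ++ B) + (2 * a₊ * δ + (b + t + 1 + 2 * u) * g)           ≡⟨ cong₂ (λ z o → Φ w (D ++ B) + (2 * z * δ + (b + t + o + 2 * u) * g)) (sym a₊≡) (sym ε≡) ⟩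
          Φ w (D ++ B) + (2 * (a + a′) * δ + (b + t + (ε + ε′) + 2 * u) * g)
                                                                          ≡⟨ ring₁ (Φ w (D ++ B)) a a′ δ b t ε ε′ u g ⟩
          Φ w (D ++ B) + (2 * a′ * δ + (b + t) * g + (ε′ + 2 * u) * g) + (2 * a * δ + ε * g)
                                                                          ≤⟨ +-monoˡ-≤ (2 * a * δ + ε * g) (+-monoʳ-≤ (Φ w (D ++ B))
                                                                               (+-mono-≤ (+-monoʳ-≤ (2 * a′ * δ) small) (*-monoʳ-≤ (ε′ + 2 * u) g≤δ))) ⟩
          Φ w (D ++ B) + (2 * a′ * δ + b * δ + (ε′ + 2 * u) * δ) + (2 * a * δ + ε * g)
                                                                          ≡⟨ cong (λ z → Φ w (D ++ B) + z + (2 * a * δ + ε * g)) (ring₂ a′ b ε′ u δ) ⟩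
          Φ w (D ++ B) + j * δ + (2 * a * δ + ε * g)                      ≡⟨ cong (_+ (2 * a * δ + ε * g)) (Φ-replicate adj-irrefl w j v (D ++ B)) ⟨
          Φ w (replicate j v ++ (D ++ B)) + (2 * a * δ + ε * g)           ∎)
          where
          a = ⌊ length D /2⌋
          ε = parity (length D)
          a′ = a₊ ∸ a
          ε′ = 1 ∸ ε
          a₊≡ : a + a′ ≡ a₊
          a₊≡ = m+[n∸m]≡n (∈⇒≤sum (λ C → ⌊ length C /2⌋) D∈)
          ε≡ : ε + ε′ ≡ 1
          ε≡ = m+[n∸m]≡n (parity-≤1 (length D))
          -- This is 2 s + 1 - ∣D ∪ B∣; ε′ corrects the parity when ∣D∣ is even.
          j = b + 2 * a′ + 2 * u + ε′
          len≡ : length (replicate j v ++ (D ++ B)) ≡ 2 * s + 1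
          len≡ = begin-equality
            length (replicate j v ++ (D ++ B))            ≡⟨ trans (length-++ (replicate j v)) (cong₂ _+_ (length-replicate j) (length-++ D)) ⟩
            j + (length D + b)                            ≡⟨ cong (λ z → j + (z + b)) (2*half+parity (length D)) ⟨
            j + (2 * a + ε + b)                           ≡⟨ ring₃ b a a′ u ε ε′ ⟩
            2 * (b + (a + a′) + u) + (ε + ε′)             ≡⟨ cong₂ (λ x y → 2 * (b + x + u) + y) a₊≡ ε≡ ⟩
            2 * (b + a₊ + u) + 1                          ≡⟨ cong (λ z → 2 * z + 1) s≡ ⟨
            2 * s + 1                                     ∎
            where
            ring₃ : ∀ b a a′ u ε ε′ → b + 2 * a′ + 2 * u + ε′ + (2 * a + ε + b) ≡ 2 * (b + (a + a′) + u) + (ε + ε′)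
            ring₃ = solve-∀
          ring₁ : ∀ x a a′ δ b t ε ε′ u g → x + (2 * (a + a′) * δ + (b + t + (ε + ε′) + 2 * u) * g) ≡
            x + (2 * a′ * δ + (b + t) * g + (ε′ + 2 * u) * g) + (2 * a * δ + ε * g)
          ring₁ = solve-∀
          ring₂ : ∀ a′ b ε′ u δ → 2 * a′ * δ + b * δ + (ε′ + 2 * u) * δ ≡ (b + 2 * a′ + 2 * u + ε′) * δ
          ring₂ = solve-∀

        -- The q copies of `d` contribute q g, which covers (b + t + 1) g. Each of the S copies of
        -- `x` lies in h cliques with every copy of `d`, hence in at least q h ≥ (b + t) h ≥ 2 δ,
        -- which pays for a pair of a component or for two surplus shares.
        cover : b * δ < (b + t) * g → Cover w s t (V ++ B)
        cover large = d , replicate q d ++ (replicate S x ++ B) , len≡ ,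
          ++⁺ʳ _ ⊆-refl , (begin
          Φ w (V ++ B)                                              ≤⟨ Φ-components w (β g δ) B Cs disc comp ⟩
          Φ w B + sum (map (β g δ) Cs)                              ≡⟨ cong (Φ w B +_) Σβ≡ ⟩
          Φ w B + (2 * a₊ * δ + (b + t + 1 + 2 * u) * g)            ≡⟨ cong (Φ w B +_) (ring₁ a₊ δ b t u g) ⟩
          Φ w B + (2 * a₊ * δ + 2 * u * g + (b + t + 1) * g)        ≤⟨ +-monoʳ-≤ (Φ w B) (+-monoˡ-≤ ((b + t + 1) * g) (+-monoʳ-≤ (2 * a₊ * δ) (*-monoʳ-≤ (2 * u) g≤δ))) ⟩
          Φ w B + (2 * a₊ * δ + 2 * u * δ + (b + t + 1) * g)        ≡⟨ cong (λ z → Φ w B + (z + (b + t + 1) * g)) (ring₂ a₊ u δ) ⟩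
          Φ w B + (S * (2 * δ) + (b + t + 1) * g)                   ≤⟨ +-mono-≤ (Φ-mono w (++⁺ˡ (replicate S x) ⊆-refl))
                                                                         (+-mono-≤ (*-monoʳ-≤ S (≤-trans 2δ≤ (*-monoˡ-≤ h b+t≤q))) (*-monoˡ-≤ g b+t+1≤q)) ⟩
          Φ w (replicate S x ++ B) + (S * (q * h) + q * g)          ≡⟨ cong (Φ w (replicate S x ++ B) +_) (ring₃ S q h g) ⟩
          Φ w (replicate S x ++ B) + q * (g + S * h)                ≡⟨ cong (λ z → Φ w (replicate S x ++ B) + q * z) degd ⟨
          Φ w (replicate S x ++ B) + q * deg w (replicate S x ++ B) d
                                                                    ≡⟨ Φ-replicate adj-irrefl w q d (replicate S x ++ B) ⟨
          Φ w (replicate q d ++ (replicate S x ++ B))               ∎)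
          where
          X = N d B
          -- Without neighbours of `d` in `B`, g would be `w 1`, that is zero, and the assumption
          -- `large` would fail.
          X≢[] : X ≢ []
          X≢[] eq = n≮0 (≤-trans large (≤-reflexive (trans (cong (λ z → (b + t) * Φ (w ∘ suc) z) eq) (trans (cong ((b + t) *_) w1) (*-zeroʳ (b + t))))))
          xmax = argmax (deg (w ∘ suc) X) X X≢[]
          x = proj₁ xmax
          h = deg (w ∘ suc) X x
          x∈ : x ∈ X
          x∈ = proj₁ (proj₂ xmax)
          -- Equal to s - b, so that `B` together with the copies of `x` has exactly s vertices.
          S = a₊ + u
          q = s + 1 + t
          len≡ : length (replicate q d ++ (replicate S x ++ B)) ≡ 2 * s + 1 + t
          len≡ = trans (length-++ (replicate q d)) (trans (cong₂ _+_ (length-replicate q) (trans (length-++ (replicate S x)) (cong (_+ b) (length-replicate S))))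
            (trans (ring₄ s t a₊ u b) (trans (cong (λ z → s + z + 1 + t) (sym s≡)) (cong (λ z → s + z + 1 + t) (sym (+-identityʳ s))))))
            where
            ring₄ : ∀ s t a u b → s + 1 + t + (a + u + b) ≡ s + (b + a + u) + 1 + t
            ring₄ = solve-∀
          degd : deg w (replicate S x ++ B) d ≡ g + S * h
          degd = trans (cong (Φ (w ∘ suc)) (trans (N-++ d (replicate S x) B) (cong (_++ X) (filterᵇ-all (adj d) (replicate S x) (rep S)))))
            (Φ-replicate adj-irrefl (w ∘ suc) S x X)
            where
            rep : ∀ S {y} → y ∈ replicate S x → adj d y ≡ true
            rep (suc S) (here refl) = proj₂ (∈-filterᵇ⁻ (adj d) {xs = B} x∈)
            rep (suc S) (there y∈) = rep S y∈
          b+t+1≤q : b + t + 1 ≤ q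
          b+t+1≤q = ≤-trans (≤-reflexive (ring₄ b t)) (+-monoˡ-≤ t (+-monoˡ-≤ 1 (m+n≤o⇒m≤o b le)))
            where
            ring₄ : ∀ b t → b + t + 1 ≡ b + 1 + t
            ring₄ = solve-∀
          b+t≤q : b + t ≤ q
          b+t≤q = m+n≤o⇒m≤o (b + t) b+t+1≤q
          2g≤ : 2 * g ≤ b * h
          2g≤ = ≤-trans (2Φ≤ (w ∘ suc) X w1 w2 (proj₂ (proj₂ xmax))) (*-monoˡ-≤ h (length-filter (T? ∘ adj d) B))
          2δ≤ : 2 * δ ≤ (b + t) * h
          2δ≤ = cancel-≤ b t (≤-trans (nonempty X X≢[]) (length-filter (T? ∘ adj d) B)) (<⇒≤ large) 2g≤
            where
            nonempty : ∀ (xs : List A) → xs ≢ [] → 1 ≤ length xs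
            nonempty [] ne = contradiction refl ne
            nonempty (_ ∷ _) ne = s≤s z≤n
          ring₁ : ∀ a δ b t u g → 2 * a * δ + (b + t + 1 + 2 * u) * g ≡ 2 * a * δ + 2 * u * g + (b + t + 1) * g
          ring₁ = solve-∀
          ring₂ : ∀ a u δ → 2 * a * δ + 2 * u * δ ≡ (a + u) * (2 * δ)
          ring₂ = solve-∀
          ring₃ : ∀ S q h g → S * (q * h) + q * g ≡ q * (g + S * h)
          ring₃ = solve-∀

      compare : Big w s (V ++ B) ⊎ Cover w s t (V ++ B)
      compare with (b + t) * g ≤? b * δ
      ... | yes p = inj₁ (big p)
      ... | no ¬p = inj₂ (cover (≰⇒> ¬p))

    extremes : ∀ s t B Cs → AllPairs Disconnected Cs → length B + sum (map (λ C → ⌊ length C /2⌋) Cs) ≤ s →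
      length (concat Cs ++ B) ≡ 2 * s + 1 + t → Big w s (concat Cs ++ B) ⊎ Cover w s t (concat Cs ++ B)
    extremes s t B Cs disc le len with argmax (deg w B) (concat Cs) V≢[] | argmax-concat (λ C v → deg w (C ++ B) v) Cs V≢[]
      where
      open ≤-Reasoning
      V≢[] : concat Cs ≢ []
      V≢[] eq = <-irrefl refl (begin-strict
        s                           ≤⟨ m≤m+n s _ ⟩
        2 * s                       <⟨ m<m+n _ (s≤s z≤n) ⟩
        2 * s + 1                   ≤⟨ m≤m+n _ t ⟩
        2 * s + 1 + t               ≡⟨ len ⟨
        length (concat Cs ++ B)     ≡⟨ cong (λ z → length (z ++ B)) eq ⟩
        length B                    ≤⟨ m+n≤o⇒m≤o (length B) le ⟩
        s                           ∎)
    ... | d , d∈ , dmax | D , v , D∈ , vmax with ∈-concat⁻′ Cs d∈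
    ...   | C₀ , d∈C₀ , C₀∈ = compare s t B Cs disc le len d v D D∈ (λ C∈ x∈ → dmax (∈-concat⁺′ x∈ C∈)) vmax
              -- g ≤ δ: adding its own component `C₀` to `B` cannot lower the degree of `d`.
              (≤-trans (deg-mono w d (++⁺ˡ C₀ ⊆-refl)) (vmax C₀∈ d∈C₀))

module _ {A : Set} (adj : A → A → Bool) (adj-sym : ∀ x y → adj x y ≡ adj y x) {B : Set} (f : B → A) where
  private
    module C = Cliques adj adj-sym
    module C′ = Cliques (λ x y → adj (f x) (f y)) (λ x y → adj-sym (f x) (f y))

  Φ∣-map : ∀ w P xs → C.Φ∣ w P (map f xs) ≡ C′.Φ∣ w (P ∘ f) xs
  Φ∣-map w P [] = refl
  Φ∣-map w P (x ∷ xs) with P (f x)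
  ... | true = cong₂ _+_ (Φ∣-map w P xs) (Φ∣-map (w ∘ suc) _ xs)
  ... | false = cong (_+ 0) (Φ∣-map w P xs)

-- Cliques as subsets

allIn : ∀ {m} → (Fin m → Bool) → Subset m → Bool
allIn P [] = true
allIn P (b ∷ S) = (if b then P zero else true) ∧ allIn (P ∘ suc) S

-- Recursion along the subset looks at each pair once, in step with the recursion of `Φ∣` on
-- `allFin`.
isClique : ∀ {m} → (Fin m → Fin m → Bool) → Subset m → Bool
isClique adj [] = true
isClique adj (b ∷ S) = (if b then allIn (adj zero ∘ suc) S else true) ∧ isClique (λ i j → adj (suc i) (suc j)) S

allIn-∧ : ∀ {m} (P Q : Fin m → Bool) S → allIn (λ i → P i ∧ Q i) S ≡ allIn P S ∧ allIn Q S
allIn-∧ P Q [] = refl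
allIn-∧ P Q (false ∷ S) = allIn-∧ (P ∘ suc) (Q ∘ suc) S
allIn-∧ P Q (true ∷ S) rewrite allIn-∧ (P ∘ suc) (Q ∘ suc) S with P zero | Q zero
... | false | _ = refl
... | true | true = refl
... | true | false with allIn (P ∘ suc) S
...   | true = refl
...   | false = refl

Σ-subsets : ∀ {m} → (Subset m → ℕ) → ℕ
Σ-subsets {m} f = sum (map f (allSubsets m))

sum-map-cong : ∀ {A : Set} {f g : A → ℕ} → f ≗ g → ∀ xs → sum (map f xs) ≡ sum (map g xs)
sum-map-cong h xs = cong sum (map-cong h xs)

Σ-subsets-suc : ∀ {m} (f : Subset (suc m) → ℕ) → Σ-subsets f ≡ Σ-subsets (f ∘ (false ∷_)) + Σ-subsets (f ∘ (true ∷_))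
Σ-subsets-suc {m} f = begin
  sum (map f (map (true ∷_) Ss ++ map (false ∷_) Ss))                   ≡⟨ cong sum (map-++ f (map (true ∷_) Ss) _) ⟩
  sum (map f (map (true ∷_) Ss) ++ map f (map (false ∷_) Ss))           ≡⟨ sum-++ (map f (map (true ∷_) Ss)) _ ⟩
  sum (map f (map (true ∷_) Ss)) + sum (map f (map (false ∷_) Ss))      ≡⟨ cong₂ (λ x y → sum x + sum y) (map-∘ Ss) (map-∘ Ss) ⟨
  Σ-subsets (f ∘ (true ∷_)) + Σ-subsets (f ∘ (false ∷_))                ≡⟨ +-comm (Σ-subsets (f ∘ (true ∷_))) _ ⟩
  Σ-subsets (f ∘ (false ∷_)) + Σ-subsets (f ∘ (true ∷_))                ∎
  where
  open ≡-Reasoning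
  Ss = allSubsets m

-- Subsets without and with vertex `zero` give the two summands of `Φ∣`; in the second, adjacency to
-- `zero` joins the predicate.
Σ-cliques : ∀ m (adj : Fin m → Fin m → Bool) adj-sym w P →
  Σ-subsets (λ S → if allIn P S ∧ isClique adj S then w ∣ S ∣ else 0) ≡ Cliques.Φ∣ adj adj-sym w P (allFin m)
Σ-cliques zero adj adj-sym w P = +-identityʳ _
Σ-cliques (suc m) adj adj-sym w P = begin
  Σ-subsets f                                                           ≡⟨ Σ-subsets-suc f ⟩
  Σ-subsets (f ∘ (false ∷_)) + Σ-subsets (f ∘ (true ∷_))                ≡⟨ cong₂ _+_ without with-zero ⟩
  Φ∣ w P (map suc (allFin m)) + (if P zero then Φ∣ (w ∘ suc) (λ y → P y ∧ adj zero y) (map suc (allFin m)) else 0)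
                                                                        ≡⟨ cong (λ xs → Φ∣ w P (zero ∷ xs)) (map-tabulate id suc) ⟩
  Φ∣ w P (allFin (suc m))                                               ∎
  where
  open ≡-Reasoning
  open Cliques adj adj-sym using (Φ∣)
  adj′ : Fin m → Fin m → Bool
  adj′ i j = adj (suc i) (suc j)
  f : Subset (suc m) → ℕ
  f S = if allIn P S ∧ isClique adj S then w ∣ S ∣ else 0
  without : Σ-subsets (f ∘ (false ∷_)) ≡ Φ∣ w P (map suc (allFin m))
  without = trans (Σ-cliques m adj′ (λ i j → adj-sym (suc i) (suc j)) w (P ∘ suc)) (sym (Φ∣-map adj adj-sym suc w P (allFin m)))
  Q : Fin m → Bool
  Q i = P (suc i) ∧ adj zero (suc i)
  link : ∀ S → (allIn (P ∘ suc) S ∧ (allIn (adj zero ∘ suc) S ∧ isClique adj′ S)) ≡ allIn Q S ∧ isClique adj′ S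
  link S = trans (sym (Bool.∧-assoc (allIn (P ∘ suc) S) _ _)) (cong (_∧ isClique adj′ S) (sym (allIn-∧ (P ∘ suc) (adj zero ∘ suc) S)))
  zeros : ∀ {A : Set} (xs : List A) → sum (map (const 0) xs) ≡ 0
  zeros [] = refl
  zeros (_ ∷ xs) = zeros xs
  with-zero : Σ-subsets (f ∘ (true ∷_)) ≡ (if P zero then Φ∣ (w ∘ suc) (λ y → P y ∧ adj zero y) (map suc (allFin m)) else 0)
  with-zero with P zero
  ... | false = zeros (allSubsets m)
  ... | true = trans (sum-map-cong (λ S → cong (λ b → if b then w (suc ∣ S ∣) else 0) (link S)) (allSubsets m))
                 (trans (Σ-cliques m adj′ (λ i j → adj-sym (suc i) (suc j)) (w ∘ suc) Q) (sym (Φ∣-map adj adj-sym suc (w ∘ suc) _ (allFin m))))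

≡-by-truth : ∀ {a b : Bool} → (a ≡ true → b ≡ true) → (b ≡ true → a ≡ true) → a ≡ b
≡-by-truth {true} {b} to from = sym (to refl)
≡-by-truth {false} {false} to from = refl
≡-by-truth {false} {true} to from = from refl

∧-true⁻ : ∀ a {b} → a ∧ b ≡ true → a ≡ true × b ≡ true
∧-true⁻ true h = refl , h

∧-true⁺ : ∀ {a b} → a ≡ true → b ≡ true → a ∧ b ≡ true
∧-true⁺ refl h = h

≡ᵇ-true⁻ : ∀ {a b} → (a ≡ᵇ b) ≡ true → a ≡ b
≡ᵇ-true⁻ {a} {b} h = ≡ᵇ⇒≡ a b (Equivalence.from Bool.T-≡ h)

≡ᵇ-true⁺ : ∀ {a b} → a ≡ b → (a ≡ᵇ b) ≡ true
≡ᵇ-true⁺ {a} {b} h = Equivalence.to Bool.T-≡ (≡⇒≡ᵇ a b h)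

≡ᵇ-false⁺ : ∀ {a b} → a ≢ b → (a ≡ᵇ b) ≡ false
≡ᵇ-false⁺ ne = Bool.¬-not (ne ∘ ≡ᵇ-true⁻)

IsClique : ∀ {m} → (Fin m → Fin m → Bool) → Subset m → Set
IsClique adj S = ∀ i j → lookup S i ≡ true → lookup S j ≡ true → i ≢ j → adj i j ≡ true

allIn⁻ : ∀ {m} (P : Fin m → Bool) S → allIn P S ≡ true → ∀ i → lookup S i ≡ true → P i ≡ true
allIn⁻ P (true ∷ S) h zero Si = proj₁ (∧-true⁻ (P zero) h)
allIn⁻ P (b ∷ S) h (suc i) Si = allIn⁻ (P ∘ suc) S (proj₂ (∧-true⁻ (if b then P zero else true) h)) i Si

allIn⁺ : ∀ {m} (P : Fin m → Bool) S → (∀ i → lookup S i ≡ true → P i ≡ true) → allIn P S ≡ true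
allIn⁺ P [] h = refl
allIn⁺ P (true ∷ S) h = ∧-true⁺ (h zero refl) (allIn⁺ (P ∘ suc) S (h ∘ suc))
allIn⁺ P (false ∷ S) h = allIn⁺ (P ∘ suc) S (h ∘ suc)

isClique⁻ : ∀ {m} (adj : Fin m → Fin m → Bool) → (∀ x y → adj x y ≡ adj y x) → ∀ S → isClique adj S ≡ true → IsClique adj S
isClique⁻ adj adj-sym (b ∷ S) h zero zero Si Sj ne = contradiction refl ne
isClique⁻ adj adj-sym (true ∷ S) h zero (suc j) Si Sj ne = allIn⁻ _ S (proj₁ (∧-true⁻ (allIn (adj zero ∘ suc) S) h)) j Sj
isClique⁻ adj adj-sym (true ∷ S) h (suc i) zero Si Sj ne =
  trans (adj-sym (suc i) zero) (allIn⁻ _ S (proj₁ (∧-true⁻ (allIn (adj zero ∘ suc) S) h)) i Si)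
isClique⁻ adj adj-sym (b ∷ S) h (suc i) (suc j) Si Sj ne =
  isClique⁻ _ (λ x y → adj-sym (suc x) (suc y)) S (proj₂ (∧-true⁻ (if b then allIn (adj zero ∘ suc) S else true) h)) i j Si Sj (ne ∘ cong suc)

isClique⁺ : ∀ {m} (adj : Fin m → Fin m → Bool) S → IsClique adj S → isClique adj S ≡ true
isClique⁺ adj [] h = refl
isClique⁺ adj (true ∷ S) h = ∧-true⁺ (allIn⁺ _ S (λ i Si → h zero (suc i) refl Si (λ ())))
  (isClique⁺ _ S (λ i j Si Sj ne → h (suc i) (suc j) Si Sj (ne ∘ suc-injectiveᶠ)))
isClique⁺ adj (false ∷ S) h = isClique⁺ _ S (λ i j Si Sj ne → h (suc i) (suc j) Si Sj (ne ∘ suc-injectiveᶠ))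

and⁻ : ∀ {bs} → and bs ≡ true → ∀ {b} → b ∈ bs → b ≡ true
and⁻ {b ∷ bs} h (here refl) = proj₁ (∧-true⁻ b h)
and⁻ {b ∷ bs} h (there b∈) = and⁻ (proj₂ (∧-true⁻ b h)) b∈

and⁺ : ∀ {bs} → (∀ {b} → b ∈ bs → b ≡ true) → and bs ≡ true
and⁺ {[]} h = refl
and⁺ {b ∷ bs} h = ∧-true⁺ (h (here refl)) (and⁺ (h ∘ there))

isCliqueᵇ≡isClique : ∀ {n} (G : Graph n) S → isCliqueᵇ G S ≡ isClique (adj G) S
isCliqueᵇ≡isClique {n} G S = ≡-by-truth (isClique⁺ (adj G) S ∘ to) (from ∘ isClique⁻ (adj G) (Graph.sym G) S)
  where
  entry : Fin n → Fin n → Bool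
  entry i j = if (lookup S i ∧ lookup S j ∧ not (i =ᶠ j)) then adj G i j else true
  row : Fin n → List Bool
  row i = map (entry i) (allFin n)
  to : isCliqueᵇ G S ≡ true → IsClique (adj G) S
  to h i j Si Sj ne with and⁻ h (∈-concat⁺′ (∈-map⁺ (entry i) (∈-allFin j)) (∈-map⁺ row (∈-allFin i)))
  ... | e rewrite Si | Sj | ≡ᵇ-false⁺ {toℕ i} {toℕ j} (ne ∘ toℕ-injective) = e
  from : IsClique (adj G) S → isCliqueᵇ G S ≡ true
  from h = and⁺ all
    where
    value : ∀ i j → entry i j ≡ true
    value i j with lookup S i in Si | lookup S j in Sj | i =ᶠ j in eq
    ... | true | true | false = h i j Si Sj (λ { refl → true≢false (trans (sym (≡ᵇ-true⁺ {toℕ i} refl)) eq) })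
    ... | true | true | true = refl
    ... | true | false | _ = refl
    ... | false | _ | _ = refl
    all : ∀ {b} → b ∈ concat (map row (allFin n)) → b ≡ true
    all b∈ with ∈-concat⁻′ (map row (allFin n)) b∈
    ... | _ , b∈′ , r∈ with ∈-map⁻ row r∈
    ...   | i , _ , refl with ∈-map⁻ (entry i) b∈′
    ...     | j , _ , refl = value i j

exactly : ℕ → ℕ → ℕ
exactly r j = if j ≡ᵇ r then 1 else 0

count≡sum : ∀ {A : Set} (p : A → Bool) xs → count p xs ≡ sum (map (λ x → if p x then 1 else 0) xs)
count≡sum p [] = refl
count≡sum p (x ∷ xs) with p x
... | true = cong suc (count≡sum p xs)
... | false = count≡sum p xs

NK≡Φ : ∀ {n} (G : Graph n) r → NK G r ≡ Cliques.Φ (adj G) (Graph.sym G) (exactly r) (allFin n)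
NK≡Φ {n} G r = trans (count≡sum _ (allSubsets n))
  (trans (sum-map-cong pointwise (allSubsets n)) (Σ-cliques n (adj G) (Graph.sym G) (exactly r) (const true)))
  where
  pointwise : ∀ S → (if (∣ S ∣ ≡ᵇ r) ∧ isCliqueᵇ G S then 1 else 0) ≡ (if allIn (const true) S ∧ isClique (adj G) S then exactly r ∣ S ∣ else 0)
  pointwise S rewrite isCliqueᵇ≡isClique G S | allIn⁺ (const true) S (λ _ _ → refl) with ∣ S ∣ ≡ᵇ r | isClique (adj G) S
  ... | true | true = refl
  ... | true | false = refl
  ... | false | true = refl
  ... | false | false = refl

-- Complete multipartite graphs

part : ∀ {A : Set} → (A → ℕ) → List A → ℕ → ℕ
part p xs l = count (λ x → p x ≡ᵇ l) xs

parts : ∀ {A : Set} → (A → ℕ) → List ℕ → List A → List ℕ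
parts p ls xs = map (part p xs) ls

module _ {A : Set} (p : A → ℕ) (l : ℕ) (xs : List A) where
  inside outside : List A
  inside = filterᵇ (λ x → p x ≡ᵇ l) xs
  outside = filterᵇ (λ x → not (p x ≡ᵇ l)) xs

  inside⁻ : ∀ {x} → x ∈ inside → x ∈ xs × p x ≡ l
  inside⁻ x∈ with ∈-filterᵇ⁻ (λ x → p x ≡ᵇ l) {xs = xs} x∈
  ... | x∈xs , eq = x∈xs , ≡ᵇ-true⁻ eq

  outside⁻ : ∀ {x} → x ∈ outside → x ∈ xs × p x ≢ l
  outside⁻ x∈ with ∈-filterᵇ⁻ (λ x → not (p x ≡ᵇ l)) {xs = xs} x∈
  ... | x∈xs , eq = x∈xs , λ e → true≢false (trans (sym eq) (cong not (≡ᵇ-true⁺ e)))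

  inside++outside : inside ++ outside ↭ xs
  inside++outside = ↭-trans (Perm.++-comm inside outside) (filterᵇ-split (λ x → p x ≡ᵇ l) xs)

  parts-outside : ∀ {ls} → All (l ≢_) ls → parts p ls outside ≡ parts p ls xs
  parts-outside [] = refl
  parts-outside {l′ ∷ _} (ne ∷ nes) = cong₂ _∷_ (cong length (trans (filterᵇ-∘ _ _ xs) (filterᵇ-cong same xs))) (parts-outside nes)
    where
    same : ∀ x → (p x ≡ᵇ l′) ∧ not (p x ≡ᵇ l) ≡ (p x ≡ᵇ l′)
    same x with p x ≡ᵇ l′ in eq
    ... | false = refl
    ... | true = cong not (≡ᵇ-false⁺ {p x} {l} (λ e → ne (trans (sym e) (≡ᵇ-true⁻ {p x} eq))))

  labels-outside : ∀ {ls} → (∀ {x} → x ∈ xs → p x ∈ l ∷ ls) → ∀ {x} → x ∈ outside → p x ∈ ls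
  labels-outside h x∈ with outside⁻ x∈
  ... | x∈xs , ne with h x∈xs
  ...   | here eq = contradiction eq ne
  ...   | there p∈ = p∈

sum-parts : ∀ {A : Set} (p : A → ℕ) {ls} → Unique ls → ∀ xs → (∀ {x} → x ∈ xs → p x ∈ ls) → sum (parts p ls xs) ≡ length xs
sum-parts p [] [] h = refl
sum-parts p [] (x ∷ xs) h = contradiction (h (here refl)) ∉[]
sum-parts p {l ∷ ls} (l∉ ∷ uniq) xs h = begin
  length (inside p l xs) + sum (parts p ls xs)               ≡⟨ cong (λ z → length (inside p l xs) + sum z) (parts-outside p l xs l∉) ⟨
  length (inside p l xs) + sum (parts p ls (outside p l xs)) ≡⟨ cong (length (inside p l xs) +_) (sum-parts p uniq _ (labels-outside p l xs h)) ⟩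
  length (inside p l xs) + length (outside p l xs)           ≡⟨ length-++ (inside p l xs) ⟨
  length (inside p l xs ++ outside p l xs)                   ≡⟨ ↭-length (inside++outside p l xs) ⟩
  length xs                                                  ∎
  where open ≡-Reasoning

module _ {A : Set} (adj : A → A → Bool) (adj-sym : ∀ x y → adj x y ≡ adj y x) where
  open Cliques adj adj-sym

  -- A clique has at most one vertex in `R`, and any clique of `Y` extends by any vertex of `R`.
  Φ-independent-join : ∀ w R Y → (∀ {x y} → x ∈ R → y ∈ R → adj x y ≡ false) → (∀ {x y} → x ∈ R → y ∈ Y → adj x y ≡ true) →
    Φ w (R ++ Y) ≡ Φ (λ j → w j + length R * w (suc j)) Y
  Φ-independent-join w R Y indep join = trans (go R (λ z → z)) (sym (Φ∣-linear w (w ∘ suc) (length R) _ Y))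
    where
    open ≡-Reasoning
    ring₁ : ∀ a b c → a + b + c ≡ a + (c + b)
    ring₁ = solve-∀
    go : ∀ Q → (∀ {x} → x ∈ Q → x ∈ R) → Φ w (Q ++ Y) ≡ Φ w Y + length Q * Φ (w ∘ suc) Y
    go [] sub = sym (+-identityʳ _)
    go (x ∷ Q) sub = begin
      Φ w (x ∷ Q ++ Y)                                        ≡⟨ Φ-∷ w x (Q ++ Y) ⟩
      Φ w (Q ++ Y) + Φ (w ∘ suc) (N x (Q ++ Y))               ≡⟨ cong₂ _+_ (go Q (sub ∘ there)) (cong (Φ (w ∘ suc)) nbrs) ⟩
      Φ w Y + length Q * Φ (w ∘ suc) Y + Φ (w ∘ suc) Y        ≡⟨ ring₁ (Φ w Y) _ _ ⟩
      Φ w Y + suc (length Q) * Φ (w ∘ suc) Y                  ∎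
      where
      nbrs : N x (Q ++ Y) ≡ Y
      nbrs rewrite N-++ x Q Y | filterᵇ-none (adj x) Q (λ y∈ → indep (sub (here refl)) (sub (there y∈))) =
        filterᵇ-all (adj x) Y (join (sub (here refl)))

  Φ-multipartite : ∀ (p : A → ℕ) {ls} → Unique ls → ∀ w xs → (∀ {x} → x ∈ xs → p x ∈ ls) →
    (∀ {x y} → x ∈ xs → y ∈ xs → adj x y ≡ not (p x ≡ᵇ p y)) → Φ w xs ≡ E w (parts p ls xs)
  Φ-multipartite p [] w [] h m = refl
  Φ-multipartite p [] w (x ∷ xs) h m = contradiction (h (here refl)) ∉[]
  Φ-multipartite p {l ∷ ls} (l∉ ∷ uniq) w xs h m = begin
    Φ w xs                                                  ≡⟨ Φ-↭ w (inside++outside p l xs) ⟨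
    Φ w (I ++ O)                                            ≡⟨ Φ-independent-join w I O
      (λ x∈ y∈ → trans (m (proj₁ (inside⁻ p l xs x∈)) (proj₁ (inside⁻ p l xs y∈)))
        (cong not (≡ᵇ-true⁺ (trans (proj₂ (inside⁻ p l xs x∈)) (sym (proj₂ (inside⁻ p l xs y∈)))))))
      (λ x∈ y∈ → trans (m (proj₁ (inside⁻ p l xs x∈)) (proj₁ (outside⁻ p l xs y∈)))
        (cong not (≡ᵇ-false⁺ (λ e → proj₂ (outside⁻ p l xs y∈) (trans (sym e) (proj₂ (inside⁻ p l xs x∈))))))) ⟩
    Φ w′ O                                                  ≡⟨ Φ-multipartite p uniq w′ O (labels-outside p l xs h)
                                                                 (λ x∈ y∈ → m (proj₁ (outside⁻ p l xs x∈)) (proj₁ (outside⁻ p l xs y∈))) ⟩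
    E w′ (parts p ls O)                                     ≡⟨ cong (E w′) (parts-outside p l xs l∉) ⟩
    E w (parts p (l ∷ ls) xs)                               ∎
    where
    open ≡-Reasoning
    I = inside p l xs
    O = outside p l xs
    w′ : ℕ → ℕ
    w′ j = w j + length I * w (suc j)

-- Part sizes of the two extremal graphs

#< : (ℕ → Bool) → ℕ → ℕ
#< f zero = 0
#< f (suc n) = #< f n + (if f n then 1 else 0)

#<-front : ∀ f n → #< f (suc n) ≡ (if f 0 then 1 else 0) + #< (f ∘ suc) n
#<-front f zero = +-comm 0 _
#<-front f (suc n) = trans (cong (_+ (if f (suc n) then 1 else 0)) (#<-front f n)) (+-assoc (if f 0 then 1 else 0) _ _)

count-allFin : ∀ f n → count (f ∘ toℕ) (allFin n) ≡ #< f n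
count-allFin f zero = refl
count-allFin f (suc n) = trans head (sym (#<-front f n))
  where
  rest : count (f ∘ toℕ) (List.tabulate {n = n} suc) ≡ #< (f ∘ suc) n
  rest = trans (cong (count (f ∘ toℕ)) (sym (map-tabulate {n = n} id suc)))
    (trans (count-map (f ∘ toℕ) suc (allFin n)) (count-allFin (f ∘ suc) n))
  head : count (f ∘ toℕ) (allFin (suc n)) ≡ (if f 0 then 1 else 0) + #< (f ∘ suc) n
  head with f 0
  ... | true = cong suc rest
  ... | false = rest

#<-restrict : ∀ f m j → #< (λ i → (i <ᵇ m) ∧ f i) (j + m) ≡ #< f m
#<-restrict f m zero = go m ≤-refl
  where
  go : ∀ n → n ≤ m → #< (λ i → (i <ᵇ m) ∧ f i) n ≡ #< f n
  go zero le = refl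
  go (suc n) le rewrite Equivalence.to Bool.T-≡ (<⇒<ᵇ le) = cong (_+ (if f n then 1 else 0)) (go n (<⇒≤ le))
#<-restrict f m (suc j) rewrite Bool.¬-not (λ e → m+n≮n j m (<ᵇ⇒< (j + m) m (Equivalence.from Bool.T-≡ e))) =
  trans (+-identityʳ _) (#<-restrict f m j)

residue : ℕ → ℕ → ℕ → ℕ
residue k m l = #< (λ i → modP i k ≡ᵇ l) m

-- The range of `x` includes the full block `suc k`: having completed q + 1 blocks is the same as
-- having x = `suc k` after q of them, and this carries the induction across a block.
residue-value : ∀ k q x l → x ≤ suc k → l < suc k → residue (suc k) (x + q * suc k) l ≡ q + (if l <ᵇ x then 1 else 0)
residue-value k zero zero l _ _ = refl
residue-value k (suc q) zero l _ l<k = trans (residue-value k q (suc k) l ≤-refl l<k)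
  (trans (cong (λ b → q + (if b then 1 else 0)) (Equivalence.to Bool.T-≡ (<⇒<ᵇ l<k))) (trans (+-comm q 1) (sym (+-identityʳ _))))
residue-value k q (suc x) l x<k l<k = trans
  (cong₂ (λ a y → a + (if y ≡ᵇ l then 1 else 0)) (residue-value k q x l (<⇒≤ x<k) l<k)
    (trans ([m+kn]%n≡m%n x q (suc k)) (m<n⇒m%n≡m x<k)))
  (trans (+-assoc q _ _) (cong (q +_) (step x l)))
  where
  step : ∀ x l → (if l <ᵇ x then 1 else 0) + (if x ≡ᵇ l then 1 else 0) ≡ (if l <ᵇ suc x then 1 else 0)
  step zero zero = refl
  step zero (suc l) = refl
  step (suc x) zero = refl
  step (suc x) (suc l) = step x l

turanParts : ℕ → ℕ → List ℕ
turanParts k m = map (residue k m) (upTo k)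

modP-< : ∀ i k → 1 ≤ k → modP i k < k
modP-< i (suc k) _ = m%n<n i (suc k)

turanParts-balanced : ∀ k m → 1 ≤ k → Balanced (turanParts k m)
turanParts-balanced (suc k) m _ x∈ y∈ = ≤-trans (proj₂ (range x∈)) (s≤s (proj₁ (range y∈)))
  where
  q = m / suc k
  range : ∀ {x} → x ∈ turanParts (suc k) m → q ≤ x × x ≤ suc q
  range x∈ with ∈-map⁻ (residue (suc k) m) x∈
  ... | l , l∈ , refl = subst (λ z → q ≤ z × z ≤ suc q) (sym val) (m≤m+n q _ , ≤-trans (+-monoʳ-≤ q (bit (l <ᵇ m % suc k))) (≤-reflexive (+-comm q 1)))
    where
    bit : ∀ b → (if b then 1 else 0) ≤ 1
    bit true = ≤-refl
    bit false = z≤n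
    val : residue (suc k) m l ≡ q + (if l <ᵇ m % suc k then 1 else 0)
    val = trans (cong (λ z → residue (suc k) z l) (m≡m%n+[m/n]*n m (suc k)))
      (residue-value k q (m % suc k) l (<⇒≤ (m%n<n m (suc k))) (∈-upTo⁻ l∈))

turanParts-sum : ∀ k m → 1 ≤ k → sum (turanParts k m) ≡ m
turanParts-sum k m 1≤k = trans (cong sum (map-cong (λ l → sym (count-allFin (λ i → modP i k ≡ᵇ l) m)) (upTo k)))
  (trans (sum-parts (λ i → modP (toℕ i) k) (upTo⁺ k) (allFin m) (λ {i} _ → ∈-upTo⁺ (modP-< (toℕ i) k 1≤k))) (length-tabulate id))

turanParts-length : ∀ k m → length (turanParts k m) ≡ k
turanParts-length k m = trans (length-map (residue k m) (upTo k)) (length-upTo k)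

NK-Turan : ∀ k m r → 1 ≤ k → NK (Turan k m) r ≡ E (exactly r) (turanParts k m)
NK-Turan k m r 1≤k = trans (NK≡Φ (Turan k m) r)
  (trans (Φ-multipartite (adj (Turan k m)) (Graph.sym (Turan k m)) (λ i → modP (toℕ i) k) (upTo⁺ k) (exactly r) (allFin m)
      (λ {i} _ → ∈-upTo⁺ (modP-< (toℕ i) k 1≤k)) (λ _ _ → refl))
    (cong (E (exactly r)) (map-cong (λ l → count-allFin (λ i → modP i k ≡ᵇ l) m) (upTo k))))

-- The extremal number asks for n vertices, so T_k(m) is completed by isolated vertices, which lie
-- in no clique of at least two vertices.
paddedTuran : (k m n : ℕ) → Graph n
paddedTuran k m n = record
  { adj = λ i j → ((toℕ i <ᵇ m) ∧ (toℕ j <ᵇ m)) ∧ not (modP (toℕ i) k ≡ᵇ modP (toℕ j) k)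
  ; sym = λ i j → cong₂ _∧_ (Bool.∧-comm (toℕ i <ᵇ m) _) (Graph.sym H i j)
  ; irrefl = λ i → trans (cong (((toℕ i <ᵇ m) ∧ (toℕ i <ᵇ m)) ∧_) (irrefl H i)) (Bool.∧-zeroʳ _) }
  where
  H : Graph n
  H = multipartite (λ i → modP (toℕ i) k)

NK-paddedTuran : ∀ k m j r → 1 ≤ k → 2 ≤ r → NK (paddedTuran k m (j + m)) r ≡ NK (Turan k m) r
NK-paddedTuran k m j r 1≤k 2≤r = begin
  NK G r                                            ≡⟨ NK≡Φ G r ⟩
  Φ w (allFin n)                                    ≡⟨ Φ-↭ w (filterᵇ-split small (allFin n)) ⟨
  Φ w (big ++ low)                                  ≡⟨ isolated big (λ z → z) ⟩
  Φ w low                                           ≡⟨ Φ-multipartite (adj G) (Graph.sym G) (λ i → modP (toℕ i) k) (upTo⁺ k) w low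
                                                         (λ {i} _ → ∈-upTo⁺ (modP-< (toℕ i) k 1≤k)) complete ⟩
  E w (parts (λ i → modP (toℕ i) k) (upTo k) low)   ≡⟨ cong (E w) (map-cong size (upTo k)) ⟩
  E w (turanParts k m)                              ≡⟨ NK-Turan k m r 1≤k ⟨
  NK (Turan k m) r                                  ∎
  where
  open ≡-Reasoning
  n = j + m
  G = paddedTuran k m n
  w = exactly r
  open Cliques (adj G) (Graph.sym G)
  small : Fin n → Bool
  small i = toℕ i <ᵇ m
  big = filterᵇ (not ∘ small) (allFin n)
  low = filterᵇ small (allFin n)
  w1 : w 1 ≡ 0
  w1 = cong (λ b → if b then 1 else 0) (≡ᵇ-false⁺ (<⇒≢ 2≤r))
  big⁻ : ∀ {i} → i ∈ big → small i ≡ false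
  big⁻ {i} i∈ with small i | proj₂ (∈-filterᵇ⁻ (not ∘ small) {xs = allFin n} i∈)
  ... | false | _ = refl
  isolated : ∀ Q → (∀ {x} → x ∈ Q → x ∈ big) → Φ w (Q ++ low) ≡ Φ w low
  isolated [] sub = refl
  isolated (x ∷ Q) sub = trans (Φ-∷ w x (Q ++ low)) (trans (cong₂ _+_ (isolated Q (sub ∘ there))
    (trans (cong (Φ (w ∘ suc)) (filterᵇ-none (adj G x) (Q ++ low) none)) w1)) (+-identityʳ _))
    where
    none : ∀ {y} → y ∈ Q ++ low → adj G x y ≡ false
    none {y} _ rewrite big⁻ (sub (here refl)) = refl
  complete : ∀ {x y} → x ∈ low → y ∈ low → adj G x y ≡ not (modP (toℕ x) k ≡ᵇ modP (toℕ y) k)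
  complete x∈ y∈ rewrite proj₂ (∈-filterᵇ⁻ small {xs = allFin n} x∈) | proj₂ (∈-filterᵇ⁻ small {xs = allFin n} y∈) = refl
  size : ∀ l → part (λ i → modP (toℕ i) k) low l ≡ residue k m l
  size l = trans (cong length (trans (filterᵇ-∘ _ small (allFin n)) (filterᵇ-cong (λ i → Bool.∧-comm (modP (toℕ i) k ≡ᵇ l) (small i)) (allFin n))))
    (trans (count-allFin (λ i → (i <ᵇ m) ∧ (modP i k ≡ᵇ l)) n) (#<-restrict (λ i → modP i k ≡ᵇ l) m j))

NK-Gk : ∀ k s q r → 1 ≤ k → NK (Gk (suc k) (q + s) s) r ≡ E (exactly r) (q ∷ turanParts k s)
NK-Gk k s q r 1≤k = trans (NK≡Φ G r)
  (trans (Φ-multipartite (adj G) (Graph.sym G) (label ∘ toℕ) uniq (exactly r) (allFin n) (λ {i} _ → label∈ (toℕ i)) (λ _ _ → refl))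
    (cong (E (exactly r)) parts≡))
  where
  n = q + s
  G = Gk (suc k) n s
  label : ℕ → ℕ
  label i = if i <ᵇ s then suc (modP i k) else 0
  ls = 0 ∷ map suc (upTo k)
  uniq : Unique ls
  uniq = All.tabulate (λ x∈ eq → contradiction (trans eq (proj₂ (proj₂ (∈-map⁻ suc x∈)))) (λ ())) ∷ Unique-map⁺ suc-injective (upTo⁺ k)
  label∈ : ∀ i → label i ∈ ls
  label∈ i with i <ᵇ s
  ... | true = there (∈-map⁺ suc (∈-upTo⁺ (modP-< i k 1≤k)))
  ... | false = here refl
  tail≡ : map (part (label ∘ toℕ) (allFin n)) (map suc (upTo k)) ≡ turanParts k s
  tail≡ = trans (sym (map-∘ (upTo k))) (map-cong size (upTo k))
    where
    same : ∀ l i → (label i ≡ᵇ suc l) ≡ (i <ᵇ s) ∧ (modP i k ≡ᵇ l)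
    same l i with i <ᵇ s
    ... | true = refl
    ... | false = refl
    size : ∀ l → part (label ∘ toℕ) (allFin n) (suc l) ≡ residue k s l
    size l = trans (cong length (filterᵇ-cong (λ i → same l (toℕ i)) (allFin n)))
      (trans (count-allFin (λ i → (i <ᵇ s) ∧ (modP i k ≡ᵇ l)) n) (#<-restrict (λ i → modP i k ≡ᵇ l) s q))
  -- The independent part is not counted directly: all parts sum to q + s, and the others already
  -- sum to s.
  parts≡ : parts (label ∘ toℕ) ls (allFin n) ≡ q ∷ turanParts k s
  parts≡ = cong₂ _∷_ (+-cancelʳ-≡ s _ q (trans (cong (part (label ∘ toℕ) (allFin n) 0 +_) (trans (sym (turanParts-sum k s 1≤k)) (cong sum (sym tail≡))))
    (trans (sum-parts (label ∘ toℕ) uniq (allFin n) (λ {i} _ → label∈ (toℕ i))) (length-tabulate id)))) tail≡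

-- Copies of Kg and Mg

AllPairs-lookup : ∀ {A : Set} {R : A → A → Set} → (∀ {x y} → R x y → R y x) → ∀ {xs} → AllPairs R xs →
  ∀ i j → i ≢ j → R (List.lookup xs i) (List.lookup xs j)
AllPairs-lookup R-sym (r ∷ rs) zero zero ne = contradiction refl ne
AllPairs-lookup R-sym (r ∷ rs) zero (suc j) ne = All.lookup r (∈-lookup j)
AllPairs-lookup R-sym (r ∷ rs) (suc i) zero ne = R-sym (All.lookup r (∈-lookup i))
AllPairs-lookup R-sym (r ∷ rs) (suc i) (suc j) ne = AllPairs-lookup R-sym rs i j (ne ∘ cong suc)

adj⇒≢ : ∀ {n} (G : Graph n) {x y} → adj G x y ≡ true → x ≢ y
adj⇒≢ G xy refl = true≢false (trans (sym xy) (irrefl G _))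

Kg-adj⁺ : ∀ m {i j : Fin m} → i ≢ j → adj (Kg m) i j ≡ true
Kg-adj⁺ m {i} {j} ne = cong not (≡ᵇ-false⁺ {toℕ i} {toℕ j} (ne ∘ toℕ-injective))

clique⇒Kg⊆ : ∀ {n} (G : Graph n) ks → AllPairs (λ x y → adj G x y ≡ true) ks → Kg (length ks) ⊆ᴳ G
clique⇒Kg⊆ G ks cl = List.lookup ks , inj , λ i j ij → edges i j (adj⇒≢ (Kg (length ks)) {i} {j} ij)
  where
  edges : ∀ i j → i ≢ j → adj G (List.lookup ks i) (List.lookup ks j) ≡ true
  edges = AllPairs-lookup (λ {x} {y} xy → trans (Graph.sym G y x) xy) cl
  inj : ∀ {i j} → List.lookup ks i ≡ List.lookup ks j → i ≡ j
  inj {i} {j} eq with i ≟ j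
  ... | yes i≡j = i≡j
  ... | no ne = contradiction eq (adj⇒≢ G (edges i j ne))

half< : ∀ m (i : Fin (2 * m)) → toℕ i / 2 < m
half< m i = m<n*o⇒m/o<n (subst (toℕ i <_) (*-comm 2 m) (toℕ<n i))

half-parity-injective : ∀ {a b} → a / 2 ≡ b / 2 → a % 2 ≡ b % 2 → a ≡ b
half-parity-injective {a} {b} h p = trans (m≡m%n+[m/n]*n a 2) (trans (cong₂ (λ x y → x + y * 2) p h) (sym (m≡m%n+[m/n]*n b 2)))

parity-cases : ∀ a → a % 2 ≡ 0 ⊎ a % 2 ≡ 1
parity-cases a with a % 2 | m%n<n a 2
... | 0 | _ = inj₁ refl
... | 1 | _ = inj₂ refl
... | suc (suc _) | s≤s (s≤s ())

module _ {n} (G : Graph n) where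
  open Matchings (adj G) (Graph.sym G) (irrefl G)
  open Matching

  -- Vertices 2e and 2e + 1 of `Mg m` go to the lower end of the e-th edge of `K` and to its mate.
  matching⇒Mg⊆ : ∀ {U} (K : Matching U) m → m ≤ size K → Mg m ⊆ᴳ G
  matching⇒Mg⊆ K m le = f , inj , edges
    where
    ends : List (Fin n)
    ends = filterᵇ (lower (mate K)) vertices
    half : Fin (2 * m) → Fin m
    half i = fromℕ< (half< m i)
    end : Fin (2 * m) → Fin n
    end i = List.lookup ends (inject≤ (half i) le)
    end-lower : ∀ i → toℕ (end i) < toℕ (mate K (end i))
    end-lower i = <ᵇ⇒< _ _ (Equivalence.from Bool.T-≡
      (proj₂ (∈-filterᵇ⁻ (lower (mate K)) {xs = vertices} (∈-lookup {xs = ends} (inject≤ (half i) le)))))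
    end-injective : ∀ {i j} → end i ≡ end j → toℕ i / 2 ≡ toℕ j / 2
    end-injective {i} {j} eq with inject≤ (half i) le ≟ inject≤ (half j) le
    ... | yes e = trans (sym (toℕ-fromℕ< (half< m i))) (trans (cong toℕ (inject≤-injective le le (half i) (half j) e)) (toℕ-fromℕ< (half< m j)))
    ... | no ne = contradiction eq (AllPairs-lookup (_∘ sym) (Unique-filter⁺ (T? ∘ lower (mate K)) (allFin⁺ n)) _ _ ne)
    end-cong : ∀ {i j} → toℕ i / 2 ≡ toℕ j / 2 → end i ≡ end j
    end-cong {i} {j} eq = cong (λ z → List.lookup ends (inject≤ z le)) (fromℕ<-cong _ _ eq (half< m i) (half< m j))
    -- Otherwise both ends of one edge would be its lower end.
    end≢mate : ∀ i j → end i ≢ mate K (end j)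
    end≢mate i j eq = <-asym (end-lower i) (subst₂ (λ x y → toℕ x < toℕ y) (sym e) (sym eq) (end-lower j))
      where
      e : mate K (end i) ≡ end j
      e = trans (cong (mate K) eq) (inv K (end j))
    f : Fin (2 * m) → Fin n
    f i = if (toℕ i % 2 ≡ᵇ 0) then end i else mate K (end i)
    inj : ∀ {i j} → f i ≡ f j → i ≡ j
    inj {i} {j} eq with parity-cases (toℕ i) | parity-cases (toℕ j)
    ... | inj₁ pi | inj₁ pj rewrite pi | pj = toℕ-injective (half-parity-injective (end-injective {i} {j} eq) (trans pi (sym pj)))
    ... | inj₁ pi | inj₂ pj rewrite pi | pj = contradiction eq (end≢mate i j)
    ... | inj₂ pi | inj₁ pj rewrite pi | pj = contradiction (sym eq) (end≢mate j i)
    ... | inj₂ pi | inj₂ pj rewrite pi | pj = toℕ-injective (half-parity-injective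
          (end-injective {i} {j} (trans (sym (inv K _)) (trans (cong (mate K) eq) (inv K _)))) (trans pi (sym pj)))
    edge-end : ∀ i → adj G (end i) (mate K (end i)) ≡ true
    edge-end i = proj₂ (edge K (λ eq → end≢mate i i (sym eq)))
    edges : ∀ i j → adj (Mg m) i j ≡ true → adj G (f i) (f j) ≡ true
    edges i j ij with ∧-true⁻ (toℕ i / 2 ≡ᵇ toℕ j / 2) ij
    ... | h , _ with parity-cases (toℕ i) | parity-cases (toℕ j)
    ...   | inj₁ pi | inj₁ pj = contradiction (toℕ-injective {i = i} {j} (half-parity-injective (≡ᵇ-true⁻ h) (trans pi (sym pj)))) (adj⇒≢ (Mg m) {i} {j} ij)
    ...   | inj₂ pi | inj₂ pj = contradiction (toℕ-injective {i = i} {j} (half-parity-injective (≡ᵇ-true⁻ h) (trans pi (sym pj)))) (adj⇒≢ (Mg m) {i} {j} ij)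
    ...   | inj₁ pi | inj₂ pj rewrite pi | pj = subst (λ z → adj G (end i) (mate K z) ≡ true) (end-cong {i} {j} (≡ᵇ-true⁻ h)) (edge-end i)
    ...   | inj₂ pi | inj₁ pj rewrite pi | pj = subst (λ z → adj G (mate K (end i)) z ≡ true) (end-cong {i} {j} (≡ᵇ-true⁻ h))
              (trans (Graph.sym G _ _) (edge-end i))

labelled⇒Kg⊈ : ∀ {n} (G : Graph n) k (p : Fin n → ℕ) → (∀ i → p i < k) → (∀ i j → adj G i j ≡ true → p i ≢ p j) → ¬ Kg (suc k) ⊆ᴳ G
labelled⇒Kg⊈ G k p p<k proper (f , inj , hom) with pigeonhole (n<1+n k) (λ i → fromℕ< (p<k (f i)))
... | i , j , i<j , eq = proper (f i) (f j) (hom i j (Kg-adj⁺ (suc k) (<⇒≢ i<j ∘ cong toℕ)))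
  (trans (sym (toℕ-fromℕ< (p<k (f i)))) (trans (cong toℕ eq) (toℕ-fromℕ< (p<k (f j)))))

module _ {m : ℕ} (e : Fin m) where
  private
    bound : ∀ {x} → x < 2 → x + toℕ e * 2 < 2 * m
    bound {x} x<2 = begin-strict
      x + toℕ e * 2      <⟨ +-monoˡ-< (toℕ e * 2) x<2 ⟩
      suc (toℕ e) * 2    ≤⟨ *-monoˡ-≤ 2 (toℕ<n e) ⟩
      m * 2              ≡⟨ *-comm m 2 ⟩
      2 * m              ∎
      where open ≤-Reasoning

  end₀ end₁ : Fin (2 * m)
  end₀ = fromℕ< (bound {0} (s≤s z≤n))
  end₁ = fromℕ< (bound {1} (s≤s (s≤s z≤n)))

  toℕ-end₀ : toℕ end₀ ≡ toℕ e * 2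
  toℕ-end₀ = toℕ-fromℕ< _

  toℕ-end₁ : toℕ end₁ ≡ 1 + toℕ e * 2
  toℕ-end₁ = toℕ-fromℕ< _

  half-end₀ : toℕ end₀ / 2 ≡ toℕ e
  half-end₀ = trans (cong (_/ 2) toℕ-end₀) (m*n/n≡m (toℕ e) 2)

  half-end₁ : toℕ end₁ / 2 ≡ toℕ e
  half-end₁ = trans (cong (_/ 2) toℕ-end₁) (trans (+-distrib-/-∣ʳ 1 {toℕ e * 2} {2} (divides (toℕ e) refl)) (m*n/n≡m (toℕ e) 2))

  Mg-edge : adj (Mg m) end₀ end₁ ≡ true
  Mg-edge = ∧-true⁺ (≡ᵇ-true⁺ (trans half-end₀ (sym half-end₁)))
    (cong not (≡ᵇ-false⁺ {toℕ end₀} {toℕ end₁} (λ eq → <⇒≢ (n<1+n (toℕ e * 2)) (trans (sym toℕ-end₀) (trans eq toℕ-end₁)))))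

Mg-edge-at : ∀ {m} (i : Fin (2 * m)) → ∃ λ j → adj (Mg m) i j ≡ true
Mg-edge-at {m} i with parity-cases (toℕ i)
... | inj₁ p = end₁ e , subst (λ z → adj (Mg m) z (end₁ e) ≡ true) (sym i≡) (Mg-edge e)
  where
  e : Fin m
  e = fromℕ< (half< m i)
  i≡ : i ≡ end₀ e
  i≡ = toℕ-injective (trans (m≡m%n+[m/n]*n (toℕ i) 2) (trans (cong₂ (λ x y → x + y * 2) p (sym (toℕ-fromℕ< (half< m i)))) (sym (toℕ-end₀ e))))
... | inj₂ p = end₀ e , trans (Graph.sym (Mg m) i (end₀ e)) (subst (λ z → adj (Mg m) (end₀ e) z ≡ true) (sym i≡) (Mg-edge e))
  where
  e : Fin m
  e = fromℕ< (half< m i)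
  i≡ : i ≡ end₁ e
  i≡ = toℕ-injective (trans (m≡m%n+[m/n]*n (toℕ i) 2) (trans (cong₂ (λ x y → x + y * 2) p (sym (toℕ-fromℕ< (half< m i)))) (sym (toℕ-end₁ e))))

<ᵇ-true⁻ : ∀ {a b} → (a <ᵇ b) ≡ true → a < b
<ᵇ-true⁻ {a} {b} h = <ᵇ⇒< a b (Equivalence.from Bool.T-≡ h)

-- Residues are a proper colouring. No vertex of a matching is isolated, so 2s + 2 vertices would
-- have to fit injectively into the 2s + 1 non-isolated ones.
paddedTuran-free : ∀ k s n → 1 ≤ k → Free k s (paddedTuran k (2 * s + 1) n)
paddedTuran-free k s n 1≤k = labelled⇒Kg⊈ G k (λ i → modP (toℕ i) k) (λ i → modP-< (toℕ i) k 1≤k) proper , M-free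
  where
  m = 2 * s + 1
  G = paddedTuran k m n
  proper : ∀ i j → adj G i j ≡ true → modP (toℕ i) k ≢ modP (toℕ j) k
  proper i j ij eq = true≢false (trans (sym (proj₂ (∧-true⁻ ((toℕ i <ᵇ m) ∧ (toℕ j <ᵇ m)) ij))) (cong not (≡ᵇ-true⁺ eq)))
  M-free : ¬ Mg (suc s) ⊆ᴳ G
  M-free (f , inj , hom) with pigeonhole m<2+2s (λ i → fromℕ< (f<m i))
    where
    f<m : ∀ i → toℕ (f i) < m
    f<m i with Mg-edge-at {suc s} i
    ... | j , ij = <ᵇ-true⁻ (proj₁ (∧-true⁻ (toℕ (f i) <ᵇ m) (proj₁ (∧-true⁻ ((toℕ (f i) <ᵇ m) ∧ (toℕ (f j) <ᵇ m)) (hom i j ij)))))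
    m<2+2s : m < 2 * suc s
    m<2+2s = ≤-reflexive (ring₁ s)
      where
      ring₁ : ∀ s → 1 + (2 * s + 1) ≡ 2 * (1 + s)
      ring₁ = solve-∀
  ... | i , j , i<j , eq = <⇒≢ i<j (cong toℕ (inj (toℕ-injective (trans (sym (toℕ-fromℕ< _)) (trans (cong toℕ eq) (toℕ-fromℕ< _))))))

-- The parts are a proper colouring. The first s vertices cover all edges, so two of s + 1 matching
-- edges would share a covering vertex.
Gk-free : ∀ k s n → 1 ≤ k → Free (suc k) s (Gk (suc k) n s)
Gk-free k s n 1≤k = labelled⇒Kg⊈ G (suc k) (λ i → label (toℕ i)) (λ i → label< (toℕ i)) proper , M-free
  where
  G = Gk (suc k) n s
  label : ℕ → ℕ
  label i = if i <ᵇ s then suc (modP i k) else 0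
  label< : ∀ i → label i < suc k
  label< i with i <ᵇ s
  ... | true = s≤s (modP-< i k 1≤k)
  ... | false = s≤s z≤n
  proper : ∀ i j → adj G i j ≡ true → label (toℕ i) ≢ label (toℕ j)
  proper i j ij eq = true≢false (trans (sym ij) (cong not (≡ᵇ-true⁺ eq)))
  cover : ∀ i j → adj G i j ≡ true → toℕ i < s ⊎ toℕ j < s
  cover i j ij with toℕ i <ᵇ s in eqi | toℕ j <ᵇ s in eqj
  ... | true | _ = inj₁ (<ᵇ-true⁻ eqi)
  ... | false | true = inj₂ (<ᵇ-true⁻ eqj)
  ... | false | false = contradiction (sym ij) true≢false
  M-free : ¬ Mg (suc s) ⊆ᴳ G
  M-free (f , inj , hom) = clash (pigeonhole (n<1+n s) (λ e → fromℕ< (proj₂ (proj₂ (hit e)))))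
    where
    hit : ∀ (e : Fin (suc s)) → ∃ λ i → toℕ i / 2 ≡ toℕ e × toℕ (f i) < s
    hit e with cover (f (end₀ e)) (f (end₁ e)) (hom _ _ (Mg-edge e))
    ... | inj₁ lt = end₀ e , half-end₀ e , lt
    ... | inj₂ lt = end₁ e , half-end₁ e , lt
    clash : ¬ ∃₂ λ e e′ → toℕ e < toℕ e′ × fromℕ< (proj₂ (proj₂ (hit e))) ≡ fromℕ< (proj₂ (proj₂ (hit e′)))
    clash (e , e′ , e<e′ , eq) = <⇒≢ e<e′ (trans (sym (proj₁ (proj₂ (hit e)))) (trans (cong (λ i → toℕ i / 2) same) (proj₁ (proj₂ (hit e′)))))
      where
      same : proj₁ (hit e) ≡ proj₁ (hit e′)
      same = inj (toℕ-injective (trans (sym (toℕ-fromℕ< _)) (trans (cong toℕ eq) (toℕ-fromℕ< _))))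

-- The upper bound and its attainment

upperBound : ∀ s k r t → 3 ≤ r → 1 ≤ k → (G : Graph (2 * s + 1 + t)) → Free (suc k) s G →
  NK G r ≤ E (exactly r) (turanParts (suc k) (2 * s + 1)) ⊔ E (exactly r) (s + 1 + t ∷ turanParts k s)
upperBound s k r t 3≤r 1≤k G (K-free , M-free) with tutte-berge s (const true) (λ (K , le) → M-free (matching⇒Mg⊆ G K (suc s) le))
  where open TutteBerge (adj G) (Graph.sym G) (irrefl G)
... | B , Cs , perm , disc , le = bound (extremes w (zero-below (≤-trans (s≤s (s≤s z≤n)) 3≤r)) (zero-below 3≤r) s t B Cs disc le len)
  where
  open Cliques (adj G) (Graph.sym G)
  open Zykov (adj G) (Graph.sym G) (irrefl G)
  open Extremes (adj G) (Graph.sym G) (irrefl G)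
  open ≤-Reasoning
  w = exactly r
  n = 2 * s + 1 + t
  zero-below : ∀ {j} → j < r → w j ≡ 0
  zero-below j<r = cong (λ b → if b then 1 else 0) (≡ᵇ-false⁺ (<⇒≢ j<r))
  perm′ : concat Cs ++ B ↭ allFin n
  perm′ = ↭-trans perm (↭-reflexive (filterᵇ-all (const true) (allFin n) (λ _ → refl)))
  len : length (concat Cs ++ B) ≡ n
  len = trans (↭-length perm′) (length-tabulate id)
  NK≡ : NK G r ≡ Φ w (concat Cs ++ B)
  NK≡ = trans (NK≡Φ G r) (sym (Φ-↭ w perm′))
  -- Pairwise adjacent entries are distinct vertices of `G`, whatever the multiplicities in `xs`, so
  -- they would be a copy of the forbidden complete graph.
  free : ∀ xs → CliqueFree (suc (suc k)) xs
  free xs ks cl _ len = K-free (subst (λ m → Kg m ⊆ᴳ G) len (clique⇒Kg⊆ G ks cl))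
  bound : Big w s (concat Cs ++ B) ⊎ Cover w s t (concat Cs ++ B) → _
  bound (inj₁ (xs , lenxs , le)) = begin
    NK G r                                    ≡⟨ NK≡ ⟩
    Φ w (concat Cs ++ B)                      ≤⟨ le ⟩
    Φ w xs                                    ≤⟨ Φ-≤-balanced w xs bs (turanParts-balanced (suc k) (2 * s + 1) (s≤s z≤n))
                                                   (subst (λ l → CliqueFree (suc l) xs) (sym (turanParts-length (suc k) (2 * s + 1))) (free xs))
                                                   (≤-reflexive (trans lenxs (sym (turanParts-sum (suc k) (2 * s + 1) (s≤s z≤n))))) ⟩
    E w bs                                    ≤⟨ m≤m⊔n _ _ ⟩
    E w bs ⊔ _                                ∎
    where bs = turanParts (suc k) (2 * s + 1)
  bound (inj₂ (d , xs , lenxs , rep , le)) = begin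
    NK G r                                    ≡⟨ NK≡ ⟩
    Φ w (concat Cs ++ B)                      ≤⟨ le ⟩
    Φ w xs                                    ≤⟨ Φ-≤-balanced-with w xs q d bs (≤-trans (m≤n+m 1 s) (m≤m+n (s + 1) t)) (turanParts-balanced k s 1≤k) bs≤q
                                                   (subst (λ l → CliqueFree (suc (suc l)) xs) (sym (turanParts-length k s)) (free xs))
                                                   (≤-reflexive (trans lenxs (trans (ring₁ s t) (cong (q +_) (sym (turanParts-sum k s 1≤k)))))) rep ⟩
    E w (q ∷ bs)                              ≤⟨ m≤n⊔m _ _ ⟩
    _ ⊔ E w (q ∷ bs)                          ∎
    where
    q = s + 1 + t
    bs = turanParts k s
    bs≤q : ∀ {b} → b ∈ bs → b ≤ q
    bs≤q {b} b∈ = begin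
      b                 ≤⟨ ∈⇒≤sum id b∈ ⟩
      sum (map id bs)   ≡⟨ cong sum (map-id bs) ⟩
      sum bs            ≡⟨ turanParts-sum k s 1≤k ⟩
      s                 ≤⟨ m≤m+n s 1 ⟩
      s + 1             ≤⟨ m≤m+n (s + 1) t ⟩
      q                 ∎
    ring₁ : ∀ s t → 2 * s + 1 + t ≡ s + 1 + t + s
    ring₁ = solve-∀

theorem1p4 : (n s k r : ℕ) → 1 ≤ s → 2 * s + 1 ≤ n → 3 ≤ r → r ≤ k →
    ExEq n r k s (NK (Turan k (2 * s + 1)) r ⊔ NK (Gk k n s) r)
theorem1p4 n s zero r 1≤s n≥ 3≤r r≤k = contradiction (≤-trans 3≤r r≤k) n≮0
theorem1p4 n s (suc k) r 1≤s n≥ 3≤r r≤k with m≤n⇒∃[o]m+o≡n n≥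
... | t , refl = attained , λ G free → subst (NK G r ≤_) (sym value) (upperBound s k r t 3≤r 1≤k G free)
  where
  1≤k : 1 ≤ k
  1≤k = s≤s⁻¹ (≤-trans (≤-trans (s≤s (s≤s z≤n)) 3≤r) r≤k)
  ring₁ : ∀ s t → 2 * s + 1 + t ≡ s + 1 + t + s
  ring₁ = solve-∀
  value : NK (Turan (suc k) (2 * s + 1)) r ⊔ NK (Gk (suc k) (2 * s + 1 + t) s) r ≡
    E (exactly r) (turanParts (suc k) (2 * s + 1)) ⊔ E (exactly r) (s + 1 + t ∷ turanParts k s)
  value = cong₂ _⊔_ (NK-Turan (suc k) (2 * s + 1) r (s≤s z≤n))
    (trans (cong (λ n → NK (Gk (suc k) n s) r) (ring₁ s t)) (NK-Gk k s (s + 1 + t) r 1≤k))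
  padded : NK (paddedTuran (suc k) (2 * s + 1) (2 * s + 1 + t)) r ≡ NK (Turan (suc k) (2 * s + 1)) r
  padded = trans (cong (λ n → NK (paddedTuran (suc k) (2 * s + 1) n) r) (+-comm (2 * s + 1) t))
    (NK-paddedTuran (suc k) (2 * s + 1) t r (s≤s z≤n) (≤-trans (s≤s (s≤s z≤n)) 3≤r))
  attained : Σ (Graph (2 * s + 1 + t)) λ G → Free (suc k) s G × NK G r ≡ NK (Turan (suc k) (2 * s + 1)) r ⊔ NK (Gk (suc k) (2 * s + 1 + t) s) r
  attained with ≤-total (NK (Gk (suc k) (2 * s + 1 + t) s) r) (NK (Turan (suc k) (2 * s + 1)) r)
  ... | inj₁ le = paddedTuran (suc k) (2 * s + 1) _ , paddedTuran-free (suc k) s _ (s≤s z≤n) , trans padded (sym (m≥n⇒m⊔n≡m le))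
  ... | inj₂ le = Gk (suc k) _ s , Gk-free k s _ 1≤k , sym (m≤n⇒m⊔n≡n le)
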